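{- Let $n$ and $k$ be positive integers such that $n\ge4k$. Then, for every tree $T$ with $k$ edges, ${\rm ot}(n,T)\le(k-1)n$.
   Context: A $2$-coloring $E(K_n)=E(R)\cup E(B)$ is a partition of the edges of $K_n$ into red edges (forming $R$) and blue edges (forming $B$); $e(\cdot)$ denotes number of edges. An $(r,b)$-colored copy of a graph $G$ (with $r+b=e(G)$) is a (not necessarily induced) subgraph of $K_n$ isomorphic to $G$ with exactly $r$ red and $b$ blue edges. ${\rm ot}(n,G)$ is the minimum non-negative integer $s$ such that every $2$-coloring $E(K_n)=E(R)\cup E(B)$ with $\min\{e(R),e(B)\}>s$ contains an $(r,b)$-colored copy of $G$ for every pair of integers $r,b\ge0$ with $r+b=e(G)$. -}

module Defs where

open import Data.Bool using (Bool; true; false; T)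
open import Data.Bool.Properties using (T?)
open import Data.Fin using (Fin; zero; suc; inject₁; fromℕ; fromℕ<; toℕ; _<?_)
open import Data.Fin.Properties using (_≟_; any?; all?; toℕ-fromℕ<; toℕ<n)
open import Data.List using (List; length; filter; allFin; cartesianProduct)
open import Data.List.Properties using (length-filter; filter-≐)
open import Data.Nat as ℕ using (ℕ; zero; suc; _+_; _∸_; _⊓_; _≤_; _<_; _>_; z≤n; s≤s)
import Data.Nat.Properties as ℕₚ
open import Data.Product using (Σ; ∃; _×_; _,_; proj₁; proj₂)
open import Data.Sum as Sum using (_⊎_; inj₁; inj₂)
open import Data.Vec.Functional using (_∷_)
open import Function using (_∘_)
open import Function.Definitions using (Injective)
open import Level using (0ℓ)
open import Relation.Binary using (Rel)
open import Relation.Binary.Construct.Closure.ReflexiveTransitive using (Star)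
open import Relation.Binary.PropositionalEquality
  using (_≡_; _≢_; refl; sym; trans; cong; cong₂; subst; subst₂)
open import Relation.Nullary using (¬_; Dec; yes; no; ¬?; contradiction)
open import Relation.Nullary.Decidable
  using (map′; _×-dec_; _⊎-dec_; _→-dec_; decidable-stable)
open import Relation.Unary using (Decidable)

------------------------------------------------------------------------
-- Finite simple graphs

record Graph (n : ℕ) : Set where
  field
    adj : Fin n → Fin n → Bool

  Adj : Fin n → Fin n → Set
  Adj u v = T (adj u v)

  field
    symmetric   : ∀ u v → Adj u v → Adj v u
    irreflexive : ∀ v → ¬ Adj v v

  adj? : ∀ u v → Dec (Adj u v)
  adj? u v = T? (adj u v)

open Graph public using (Adj; adj?)

pairs : ∀ n → List (Fin n × Fin n)
pairs n = cartesianProduct (allFin n) (allFin n)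

-- Each edge {u , v} is listed once, as the pair (u , v) with u < v.

edges : ∀ {n} → Graph n → List (Fin n × Fin n)
edges {n} G = filter (λ (u , v) → (u <? v) ×-dec adj? G u v) (pairs n)

e : ∀ {n} → Graph n → ℕ
e G = length (edges G)

Connected : ∀ {n} → Graph n → Set
Connected G = ∀ u v → Star (Adj G) u v

-- A cycle has at least three vertices, all distinct.

record Cycle {n : ℕ} (G : Graph n) : Set where
  field
    ℓ        : ℕ
    vertex   : Fin (3 + ℓ) → Fin n
    distinct : Injective _≡_ _≡_ vertex
    step     : ∀ (i : Fin (2 + ℓ)) → Adj G (vertex (inject₁ i)) (vertex (suc i))
    close    : Adj G (vertex (fromℕ (2 + ℓ))) (vertex zero)

record IsTree {n : ℕ} (G : Graph n) : Set where
  field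
    nonempty  : 1 ≤ n
    connected : Connected G
    acyclic   : ¬ Cycle G

------------------------------------------------------------------------
-- 2-colorings of the complete graph on Fin n, and colored copies

record Coloring (n : ℕ) : Set where
  field
    R B      : Graph n
    cover    : ∀ u v → u ≢ v → Adj R u v ⊎ Adj B u v
    disjoint : ∀ u v → ¬ (Adj R u v × Adj B u v)

open Coloring public using (R; B)

-- The number of edges {u , v} of G whose image {f u , f v} is an edge of H.

edgesInto : ∀ {m n} → Graph m → Graph n → (Fin m → Fin n) → ℕ
edgesInto G H f = length (filter (λ (u , v) → adj? H (f u) (f v)) (edges G))

-- A not necessarily induced subgraph of the complete graph isomorphic to G
-- is the image of G under an injection of vertices: its edges are exactly
-- the {f u , f v} with {u , v} an edge of G.

record ColoredCopy {m n : ℕ} (c : Coloring n) (G : Graph m) (r b : ℕ) : Set where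
  constructor copy
  field
    f         : Fin m → Fin n
    injective : Injective _≡_ _≡_ f
    red       : edgesInto G (R c) f ≡ r
    blue      : edgesInto G (B c) f ≡ b

AllPatterns : ∀ {m n} → Coloring n → Graph m → Set
AllPatterns c G = ∀ r b → r + b ≡ e G → ColoredCopy c G r b

Forces : ∀ {m} (n : ℕ) → Graph m → ℕ → Set
Forces n G s = ∀ (c : Coloring n) → e (R c) ⊓ e (B c) > s → AllPatterns c G

IsMinimum : (ℕ → Set) → ℕ → Set
IsMinimum P s = P s × (∀ t → P t → s ≤ t)

------------------------------------------------------------------------
-- Forces is decidable, by exhaustive search, so its minimum exists.
-- Without function extensionality a search reaches each function, graph or
-- coloring only up to pointwise equality, so the predicates searched for
-- must respect that relation.

Searchable : (A : Set) → Rel A 0ℓ → Set₁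
Searchable A _≈_ = ∀ {P : A → Set} → (∀ {x y} → x ≈ y → P x → P y) →
                   Decidable P → Dec (∃ P)

search-Bool : Searchable Bool _≡_
search-Bool _ P? =
  map′ Sum.[ (true ,_) , (false ,_) ]
       (λ { (true , p) → inj₁ p ; (false , p) → inj₂ p })
       (P? true ⊎-dec P? false)

search-Fin : ∀ {n} → Searchable (Fin n) _≡_
search-Fin _ P? = any? P?

Pointwise : ∀ {A : Set} {n} → Rel A 0ℓ → Rel (Fin n → A) 0ℓ
Pointwise _≈_ f g = ∀ i → f i ≈ g i

search-Π : ∀ {A : Set} {_≈_ : Rel A _} → (∀ {x} → x ≈ x) →
           Searchable A _≈_ → ∀ n → Searchable (Fin n → A) (Pointwise _≈_)
search-Π {A} rfl search zero resp P? =
  map′ (empty ,_) (λ (_ , p) → resp (λ ()) p) (P? empty)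
  where
  empty : Fin 0 → A
  empty ()
search-Π {A} {_≈_} rfl search (suc n) {P} resp P? =
  map′ (λ (a , f , p) → a ∷ f , p)
       (λ (g , p) → g zero , g ∘ suc ,
                    resp (λ { zero → rfl ; (suc _) → rfl }) p)
       (search (λ a≈b (f , p) → f , resp (λ { zero → a≈b ; (suc _) → rfl }) p)
               (λ a → search-Π {_≈_ = _≈_} rfl search n
                        (λ f≈g → resp λ { zero → rfl ; (suc i) → f≈g i })
                        (λ f → P? (a ∷ f))))

search-adj : ∀ n → Searchable (Fin n → Fin n → Bool)
                              (Pointwise (Pointwise _≡_))
search-adj n = search-Π {_≈_ = Pointwise _≡_} (λ _ → refl)
                        (search-Π refl search-Bool n) n

_≈ᴳ_ : ∀ {n} → Rel (Graph n) 0ℓ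
G ≈ᴳ H = ∀ u v → Graph.adj G u v ≡ Graph.adj H u v

≈-sym : ∀ {n} {G H : Graph n} → G ≈ᴳ H → H ≈ᴳ G
≈-sym G≈H u v = sym (G≈H u v)

≈⇒Adj : ∀ {n} {G H : Graph n} → G ≈ᴳ H → ∀ {u v} → Adj G u v → Adj H u v
≈⇒Adj G≈H {u} {v} = subst T (G≈H u v)

search-Graph : ∀ n → Searchable (Graph n) _≈ᴳ_
search-Graph n {P} resp P? =
  map′ (λ (_ , G , _ , p) → G , p) (λ (G , p) → _ , G , (λ _ _ → refl) , p)
       (search-adj n
         (λ a≈b (G , G≈a , p) → G , (λ u v → trans (G≈a u v) (a≈b u v)) , p)
         realised?)
  where
  realised? : Decidable λ a → Σ (Graph n) λ G →
                (∀ u v → Graph.adj G u v ≡ a u v) × P G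
  realised? a
    with all? (λ u → all? λ v → T? (a u v) →-dec T? (a v u))
       | all? (λ v → ¬? (T? (a v v)))
  ... | no ¬s | _ = no λ (G , G≈a , _) → ¬s λ u v t →
        subst T (G≈a v u) (Graph.symmetric G u v (subst T (sym (G≈a u v)) t))
  ... | yes _ | no ¬i = no λ (G , G≈a , _) → ¬i λ v t →
        Graph.irreflexive G v (subst T (sym (G≈a v v)) t)
  ... | yes s | yes i =
        map′ (λ p → G₀ , (λ _ _ → refl) , p) (λ (G , G≈a , p) → resp G≈a p) (P? G₀)
    where
    G₀ : Graph n
    G₀ = record { adj = a ; symmetric = s ; irreflexive = i }

_≈ᶜ_ : ∀ {n} → Rel (Coloring n) 0ℓ
c ≈ᶜ d = R c ≈ᴳ R d × B c ≈ᴳ B d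

search-Coloring : ∀ n → Searchable (Coloring n) _≈ᶜ_
search-Coloring n {P} resp P? =
  map′ (λ (_ , _ , c , _ , p) → c , p)
       (λ (c , p) → R c , B c , c , ((λ _ _ → refl) , (λ _ _ → refl)) , p)
       (search-Graph n
         (λ G≈H (B′ , c , (r , b) , p) →
            B′ , c , ((λ u v → trans (r u v) (G≈H u v)) , b) , p)
         (λ R′ → search-Graph n
           (λ G≈H (c , (r , b) , p) →
              c , (r , (λ u v → trans (b u v) (G≈H u v))) , p)
           (realised? R′)))
  where
  realised? : ∀ R′ B′ → Dec (Σ (Coloring n) λ c → (R c ≈ᴳ R′ × B c ≈ᴳ B′) × P c)
  realised? R′ B′
    with all? (λ u → all? λ v → ¬? (u ≟ v) →-dec (adj? R′ u v ⊎-dec adj? B′ u v))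
       | all? (λ u → all? λ v → ¬? (adj? R′ u v ×-dec adj? B′ u v))
  ... | no ¬c | _ = no λ (c , (r , b) , _) → ¬c λ u v u≢v →
        Sum.map (≈⇒Adj {G = R c} {R′} r) (≈⇒Adj {G = B c} {B′} b)
                (Coloring.cover c u v u≢v)
  ... | yes _ | no ¬d = no λ (c , (r , b) , _) → ¬d λ u v (x , y) →
        Coloring.disjoint c u v
          ( ≈⇒Adj {G = R′} {R c} (≈-sym {G = R c} {R′} r) x
          , ≈⇒Adj {G = B′} {B c} (≈-sym {G = B c} {B′} b) y)
  ... | yes k | yes d =
        map′ (λ p → c₀ , ((λ _ _ → refl) , (λ _ _ → refl)) , p)
             (λ (c , c≈ , p) → resp c≈ p) (P? c₀)
    where
    c₀ : Coloring n
    c₀ = record { R = R′ ; B = B′ ; cover = k ; disjoint = d }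

e-cong : ∀ {n} {G H : Graph n} → G ≈ᴳ H → e G ≡ e H
e-cong {n} {G} {H} G≈H = cong length
  (filter-≐ _ _ ( (λ (l , x) → l , ≈⇒Adj {G = G} {H} G≈H x)
                , (λ (l , x) → l , ≈⇒Adj {G = H} {G} (≈-sym {G = G} {H} G≈H) x))
            (pairs n))

edgesInto-cong : ∀ {m n} (G : Graph m) {H K : Graph n} {f g : Fin m → Fin n} →
                 H ≈ᴳ K → (∀ i → f i ≡ g i) → edgesInto G H f ≡ edgesInto G K g
edgesInto-cong G {H} {K} {f} {g} H≈K f≗g = cong length
  (filter-≐ _ _ ( (λ {(u , v)} → subst T (eq u v))
                , (λ {(u , v)} → subst T (sym (eq u v))))
            (edges G))
  where
  eq : ∀ u v → Graph.adj H (f u) (f v) ≡ Graph.adj K (g u) (g v)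
  eq u v = trans (H≈K (f u) (f v)) (cong₂ (Graph.adj K) (f≗g u) (f≗g v))

copy? : ∀ {m n} (c : Coloring n) (G : Graph m) r b → Dec (ColoredCopy c G r b)
copy? {m} {n} c G r b =
  map′ (λ (f , i , x , y) → copy f (λ {u} {v} → i u v) x y)
       (λ (copy f i x y) → f , (λ u v → i) , x , y)
       (search-Π refl search-Fin m resp λ f →
         all? (λ u → all? λ v → (f u ≟ f v) →-dec (u ≟ v))
         ×-dec (edgesInto G (R c) f ℕ.≟ r)
         ×-dec (edgesInto G (B c) f ℕ.≟ b))
  where
  resp : ∀ {f g : Fin m → Fin n} → (∀ i → f i ≡ g i) →
         (∀ u v → f u ≡ f v → u ≡ v) ×
           edgesInto G (R c) f ≡ r × edgesInto G (B c) f ≡ b →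
         (∀ u v → g u ≡ g v → u ≡ v) ×
           edgesInto G (R c) g ≡ r × edgesInto G (B c) g ≡ b
  resp f≗g (i , x , y) =
      (λ u v gu≡gv → i u v (trans (f≗g u) (trans gu≡gv (sym (f≗g v)))))
    , trans (sym (edgesInto-cong G {R c} {R c} (λ _ _ → refl) f≗g)) x
    , trans (sym (edgesInto-cong G {B c} {B c} (λ _ _ → refl) f≗g)) y

allPatterns? : ∀ {m n} (c : Coloring n) (G : Graph m) → Dec (AllPatterns c G)
allPatterns? c G =
  map′ to from (all? λ (r : Fin (suc (e G))) → copy? c G (toℕ r) (e G ∸ toℕ r))
  where
  to : (∀ (r : Fin (suc (e G))) → ColoredCopy c G (toℕ r) (e G ∸ toℕ r)) →
       AllPatterns c G
  to h r b r+b≡e = subst₂ (ColoredCopy c G) r′≡r b′≡b (h (fromℕ< r<))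
    where
    r< : r < suc (e G)
    r< = s≤s (subst (r ≤_) r+b≡e (ℕₚ.m≤m+n r b))
    r′≡r : toℕ (fromℕ< r<) ≡ r
    r′≡r = toℕ-fromℕ< r<
    b′≡b : e G ∸ toℕ (fromℕ< r<) ≡ b
    b′≡b = trans (cong₂ _∸_ (sym r+b≡e) r′≡r) (ℕₚ.m+n∸m≡n r b)
  from : AllPatterns c G → ∀ (r : Fin (suc (e G))) →
         ColoredCopy c G (toℕ r) (e G ∸ toℕ r)
  from h r = h (toℕ r) (e G ∸ toℕ r) (ℕₚ.m+[n∸m]≡n (ℕₚ.≤-pred (toℕ<n r)))

forces? : ∀ {m} n (G : Graph m) → Decidable (Forces n G)
forces? n G s =
  map′ (λ ¬bad c → decidable-stable (good? c) (λ ¬g → ¬bad (c , ¬g)))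
       (λ h (c , ¬g) → ¬g (h c))
       (¬? (search-Coloring n resp (λ c → ¬? (good? c))))
  where
  Good : Coloring n → Set
  Good c = e (R c) ⊓ e (B c) > s → AllPatterns c G

  good? : Decidable Good
  good? c = (s ℕ.<? e (R c) ⊓ e (B c)) →-dec allPatterns? c G

  resp : ∀ {c d} → c ≈ᶜ d → ¬ Good c → ¬ Good d
  resp {c} {d} (r≈ , b≈) ¬gc gd = ¬gc λ s< p q eq →
    let copy f i x y = gd (subst (s <_) (cong₂ _⊓_ (e-cong {G = R c} {R d} r≈)
                                                   (e-cong {G = B c} {B d} b≈)) s<)
                          p q eq
    in copy f i (trans (edgesInto-cong G {R c} {R d} r≈ (λ _ → refl)) x)
                (trans (edgesInto-cong G {B c} {B d} b≈ (λ _ → refl)) y)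

-- No graph on Fin n has more than length (pairs n) edges.

forces-large : ∀ {m} n (G : Graph m) → Forces n G (length (pairs n))
forces-large n G c large = contradiction
  (ℕₚ.≤-trans (ℕₚ.m⊓n≤m (e (R c)) (e (B c))) (length-filter _ (pairs n)))
  (ℕₚ.<⇒≱ large)

minimum : ∀ {P : ℕ → Set} → Decidable P → ∀ N → P N → ∃ (IsMinimum P)
minimum P? N p with P? 0
... | yes p₀ = 0 , p₀ , λ _ _ → z≤n
minimum P? zero    p | no ¬p₀ = contradiction p ¬p₀
minimum P? (suc N) p | no ¬p₀ with minimum (P? ∘ suc) N p
... | s , q , least = suc s , q ,
      λ { zero p₀ → contradiction p₀ ¬p₀ ; (suc t) pt → s≤s (least t pt) }

ot-exists : ∀ {m} n (G : Graph m) → ∃ (IsMinimum (Forces n G))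
ot-exists n G = minimum (forces? n G) (length (pairs n)) (forces-large n G)

ot : ∀ {m} → ℕ → Graph m → ℕ
ot n G = proj₁ (ot-exists n G)

ot-isMinimum : ∀ {m} n (G : Graph m) → IsMinimum (Forces n G) (ot n G)
ot-isMinimum n G = proj₂ (ot-exists n G)

{-# OPTIONS --safe #-}

-- A pattern with one colour only is embedded greedily in a subgraph of large
-- minimum degree.  For the pattern (r , b) with r, b ≥ 1, write the tree as a
-- smaller tree T₀ plus a broom: an edge w–u and edges from u to at least one
-- leaf, d ≥ 2 edges in all.  Choose ρ, β ≥ 0 with ρ + β = d − 2 such that, by
-- induction, T₀ has a copy with r − ρ − 1 red and b − β − 1 blue edges.  With O
-- the set of vertices outside that copy, O still spans more than ρ|O| red and
-- more than β|O| blue edges, so some vertex p of O has at least ρ + 1 red and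
-- β + 1 blue neighbours in O.  Whatever the colour of the edge from the image
-- of w to p, placing u at p leaves enough neighbours to complete the pattern.
module Submission where

open import Defs
open import Data.Nat using (ℕ; _*_; _∸_; _≤_; _≥_)
open import Relation.Binary.PropositionalEquality using (_≡_)
open import Data.Bool using (Bool; true; false; T; _∧_)
import Data.Fin as Fin
open import Data.Fin using (Fin; zero; suc; inject₁; fromℕ; _<?_)
open import Data.Fin.Properties using (_≟_) renaming (<-irrefl to <ᶠ-irrefl; <-asym to <ᶠ-asym)
open import Data.List using (List; []; _∷_; [_]; _++_; length; map; filter; allFin; cartesianProduct; lookup)
open import Data.List.Properties using (length-map; map-cong-local; length-filter; length-tabulate; ∷-injectiveˡ; ∷-injectiveʳ; map-++; length-++; map-∘)
open import Data.List.Membership.Propositional using (_∈_; _∉_; find; lose)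
open import Data.List.Membership.Propositional.Properties
open import Data.List.Membership.Propositional.Properties.WithK using (unique∧set⇒bag)
open import Data.List.Relation.Binary.BagAndSetEquality using (∼bag⇒↭)
open import Data.List.Relation.Binary.Permutation.Propositional using (_↭_; ↭-refl; ↭-sym; ↭-trans; prep; swap)
import Data.List.Relation.Binary.Permutation.Propositional as Perm
import Data.List.Relation.Binary.Permutation.Propositional.Properties as Permₚ
import Data.List.Relation.Binary.Permutation.Setoid.Properties as Permₛ
open import Data.List.Relation.Binary.Sublist.Propositional using ([]; _∷_; _∷ʳ_) renaming (_⊆_ to _⊑_; lookup to ⊑-lookup)
import Data.List.Relation.Binary.Sublist.Propositional.Properties as Sublist
open import Data.List.Relation.Unary.All as All using (All; []; _∷_)
import Data.List.Relation.Unary.All.Properties as Allₚ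
open import Data.List.Relation.Unary.AllPairs using (AllPairs; []; _∷_)
import Data.List.Relation.Unary.AllPairs.Properties as AllPairsₚ
open import Data.List.Relation.Unary.Any using (here; there; any?)
open import Data.List.Relation.Unary.Unique.Propositional using (Unique)
import Data.List.Relation.Unary.Unique.Propositional.Properties as Uniqueₚ
open import Data.Nat using (zero; suc; _+_; _<_; z≤n; s≤s; _≤?_)
open import Data.Nat.ListAction using (sum)
open import Data.Nat.ListAction.Properties using (sum-++; sum-↭)
open import Data.Nat.Properties hiding (_≟_; _<?_; _≤?_)
open import Data.Nat.Tactic.RingSolver using (solve-∀)
open import Data.Product using (∃; ∃₂; _×_; _,_; proj₁; proj₂; uncurry)
open import Data.Sum using (_⊎_; inj₁; inj₂)
open import Function using (_∘_; mk⇔)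
open import Function.Definitions using (Injective)
open import Relation.Binary.Construct.Closure.ReflexiveTransitive using (Star; ε; _◅_)
open import Relation.Binary.PropositionalEquality
  using (_≢_; refl; sym; trans; cong; cong₂; subst; subst₂; setoid; module ≡-Reasoning)
open import Relation.Nullary using (¬_; Dec; yes; no; ¬?; contradiction; does; _×-dec_)
open import Relation.Nullary.Decidable using (dec-true; dec-false)
open import Relation.Unary using (Decidable)

import Data.List.Membership.DecPropositional as DecMembership

private variable
  A C : Set
  x : A
  xs ys : List A
  f g : A → ℕ

-- Sums over lists and over unordered pairs of a list

∑ : (A → ℕ) → List A → ℕ
∑ f xs = sum (map f xs)

∑-cong : ∀ xs → (∀ {x} → x ∈ xs → f x ≡ g x) → ∑ f xs ≡ ∑ g xs
∑-cong []       f≗g = refl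
∑-cong (x ∷ xs) f≗g = cong₂ _+_ (f≗g (here refl)) (∑-cong xs (f≗g ∘ there))

∑-mono : ∀ xs → (∀ {x} → x ∈ xs → f x ≤ g x) → ∑ f xs ≤ ∑ g xs
∑-mono []       f≤g = z≤n
∑-mono (x ∷ xs) f≤g = +-mono-≤ (f≤g (here refl)) (∑-mono xs (f≤g ∘ there))

∑-const : ∀ c (xs : List A) → ∑ (λ _ → c) xs ≡ length xs * c
∑-const c []       = refl
∑-const c (x ∷ xs) = cong (c +_) (∑-const c xs)

∑-bounded : ∀ {c} xs → (∀ {x} → x ∈ xs → f x ≤ c) → ∑ f xs ≤ length xs * c
∑-bounded {c = c} xs f≤c = ≤-trans (∑-mono xs f≤c) (≤-reflexive (∑-const c xs))

∑-++ : ∀ (f : A → ℕ) xs {ys} → ∑ f (xs ++ ys) ≡ ∑ f xs + ∑ f ys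
∑-++ f xs {ys} = trans (cong sum (map-++ f xs ys)) (sum-++ (map f xs) (map f ys))

∑-map : ∀ (f : C → ℕ) (k : A → C) xs → ∑ f (map k xs) ≡ ∑ (f ∘ k) xs
∑-map f k xs = cong sum (sym (map-∘ xs))

∑-↭ : ∀ (f : A → ℕ) → xs ↭ ys → ∑ f xs ≡ ∑ f ys
∑-↭ f p = sum-↭ (Permₚ.map⁺ f p)

∑-+ : ∀ (f g : A → ℕ) xs → ∑ (λ x → f x + g x) xs ≡ ∑ f xs + ∑ g xs
∑-+ f g []       = refl
∑-+ f g (x ∷ xs) = trans (cong (f x + g x +_) (∑-+ f g xs)) (lemma (f x) (g x) (∑ f xs) (∑ g xs))
  where
  lemma : ∀ a b c d → a + b + (c + d) ≡ a + c + (b + d)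
  lemma = solve-∀

∑-swap : ∀ (k : A → C → ℕ) xs ys →
         ∑ (λ x → ∑ (k x) ys) xs ≡ ∑ (λ y → ∑ (λ x → k x y) xs) ys
∑-swap k []       ys = sym (trans (∑-const 0 ys) (*-zeroʳ (length ys)))
∑-swap k (x ∷ xs) ys = trans (cong (∑ (k x) ys +_) (∑-swap k xs ys)) (sym (∑-+ (k x) _ ys))

∑-positive : 1 ≤ ∑ f xs → ∃ λ x → x ∈ xs × 1 ≤ f x
∑-positive {f = f} {xs = x ∷ xs} p with f x in eq
... | suc _ = x , here refl , subst (1 ≤_) (sym eq) (s≤s z≤n)
... | zero  with y , y∈ , q ← ∑-positive {f = f} {xs} p = y , there y∈ , q

-- For the indicator of a graph this is the number of edges inside a duplicate-free list. Unfolding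
-- it once is the deletion of one vertex.
∑₂ : (A → A → ℕ) → List A → ℕ
∑₂ k []       = 0
∑₂ k (x ∷ xs) = ∑ (k x) xs + ∑₂ k xs

Symmetric : (A → A → ℕ) → Set
Symmetric k = ∀ x y → k x y ≡ k y x

∑₂-cong : ∀ {h k : A → A → ℕ} → (∀ x y → h x y ≡ k x y) → ∀ xs → ∑₂ h xs ≡ ∑₂ k xs
∑₂-cong eq []       = refl
∑₂-cong eq (x ∷ xs) = cong₂ _+_ (∑-cong xs λ {y} _ → eq x y) (∑₂-cong eq xs)

∑₂-↭ : ∀ {k : A → A → ℕ} → Symmetric k → xs ↭ ys → ∑₂ k xs ≡ ∑₂ k ys
∑₂-↭ s Perm.refl            = refl
∑₂-↭ s (prep x p)           = cong₂ _+_ (∑-↭ _ p) (∑₂-↭ s p)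
∑₂-↭ {k = k} s (swap {xs} {ys} x y p) = begin
  k x y + ∑ (k x) xs + (∑ (k y) xs + ∑₂ k xs)  ≡⟨ cong₂ (λ a b → a + ∑ (k x) xs + b) (s x y)
                                                   (cong₂ _+_ (∑-↭ _ p) (∑₂-↭ s p)) ⟩
  k y x + ∑ (k x) xs + (∑ (k y) ys + ∑₂ k ys)  ≡⟨ cong (λ a → k y x + a + (∑ (k y) ys + ∑₂ k ys)) (∑-↭ _ p) ⟩
  k y x + ∑ (k x) ys + (∑ (k y) ys + ∑₂ k ys)  ≡⟨ lemma (k y x) _ _ _ ⟩
  k y x + ∑ (k y) ys + (∑ (k x) ys + ∑₂ k ys)  ∎
  where
  open ≡-Reasoning
  lemma : ∀ a b c d → a + b + (c + d) ≡ a + c + (b + d)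
  lemma = solve-∀
∑₂-↭ s (Perm.trans p q)     = trans (∑₂-↭ s p) (∑₂-↭ s q)

∑₂-++ : ∀ (k : A → A → ℕ) xs ys →
        ∑₂ k (xs ++ ys) ≡ ∑₂ k xs + ∑ (λ x → ∑ (k x) ys) xs + ∑₂ k ys
∑₂-++ k []       ys = refl
∑₂-++ k (x ∷ xs) ys = trans (cong₂ _+_ (∑-++ (k x) xs) (∑₂-++ k xs ys)) (lemma (∑ (k x) xs) _ _ _ _)
  where
  lemma : ∀ a b c d e → a + b + (c + d + e) ≡ a + c + (b + d) + e
  lemma = solve-∀

-- The double sum sees each pair from both of its ends. This converts a bound on degrees into a
-- bound on edges, with a factor of two to spare.
∑₂≤∑∑ : ∀ (k : A → A → ℕ) xs → ∑₂ k xs ≤ ∑ (λ x → ∑ (k x) xs) xs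
∑₂≤∑∑ k []       = z≤n
∑₂≤∑∑ k (x ∷ xs) = +-mono-≤ (m≤n+m _ (k x x))
  (≤-trans (∑₂≤∑∑ k xs) (∑-mono xs λ {y} _ → m≤n+m _ (k y x)))

-- The price of removing a copy: each deleted vertex takes with it at most as many edges as the
-- whole list has entries.
∑₂-++-≤ : ∀ {k : A → A → ℕ} → (∀ x y → k x y ≤ 1) → ∀ xs ys →
          ∑₂ k (xs ++ ys) ≤ length xs * length (xs ++ ys) + ∑₂ k ys
∑₂-++-≤ k≤1 []       ys = ≤-refl
∑₂-++-≤ {k = k} k≤1 (x ∷ xs) ys = begin
  ∑ (k x) zs + ∑₂ k zs                                 ≤⟨ +-mono-≤ (∑-bounded zs λ {y} _ → k≤1 x y) (∑₂-++-≤ k≤1 xs ys) ⟩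
  length zs * 1 + (length xs * length zs + ∑₂ k ys)    ≡⟨ lemma (length zs) (length xs) (∑₂ k ys) ⟩
  length zs + length xs * length zs + ∑₂ k ys          ≤⟨ +-monoˡ-≤ (∑₂ k ys) (+-mono-≤ (n≤1+n (length zs)) (*-monoʳ-≤ (length xs) (n≤1+n (length zs)))) ⟩
  suc (length zs) + length xs * suc (length zs) + ∑₂ k ys ∎
  where
  open ≤-Reasoning
  zs = xs ++ ys
  lemma : ∀ a b c → a * 1 + (b * a + c) ≡ a + b * a + c
  lemma = solve-∀

-- Doubled, so that no division occurs.
2∑₂≤ : ∀ {k : A → A → ℕ} → (∀ x y → k x y ≤ 1) → ∀ xs →
       2 * ∑₂ k xs ≤ length xs * (length xs ∸ 1)
2∑₂≤ k≤1 [] = z≤n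
2∑₂≤ {k = k} k≤1 (x ∷ xs) = begin
  2 * (∑ (k x) xs + ∑₂ k xs)               ≡⟨ *-distribˡ-+ 2 (∑ (k x) xs) (∑₂ k xs) ⟩
  2 * ∑ (k x) xs + 2 * ∑₂ k xs             ≤⟨ +-mono-≤ (*-monoʳ-≤ 2 (∑-bounded xs λ {y} _ → k≤1 x y)) (2∑₂≤ k≤1 xs) ⟩
  2 * (length xs * 1) + length xs * (length xs ∸ 1) ≡⟨ lemma (length xs) ⟩
  suc (length xs) * length xs              ∎
  where
  open ≤-Reasoning
  lemma′ : ∀ n → 2 * (suc n * 1) + suc n * n ≡ suc (suc n) * suc n
  lemma′ = solve-∀
  lemma : ∀ n → 2 * (n * 1) + n * (n ∸ 1) ≡ suc n * n
  lemma zero    = refl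
  lemma (suc n) = lemma′ n

-- Permutations and duplicate-free lists.

Unique-resp-↭ : xs ↭ ys → Unique xs → Unique ys
Unique-resp-↭ p = Permₛ.Unique-resp-↭ (setoid _) (Perm.↭⇒↭ₛ p)

filter-split : ∀ {P : A → Set} (P? : Decidable P) xs → xs ↭ filter P? xs ++ filter (¬? ∘ P?) xs
filter-split P? [] = ↭-refl
filter-split P? (x ∷ xs) with P? x
... | yes _ = prep x (filter-split P? xs)
... | no  _ = ↭-trans (prep x (filter-split P? xs)) (↭-sym (Permₚ.shift x (filter P? xs) _))

Unique-++⁻ : ∀ (xs : List A) {ys} → Unique (xs ++ ys) →
             Unique xs × Unique ys × (∀ {v} → v ∈ ys → v ∉ xs)
Unique-++⁻ []       ys!          = [] , ys! , λ _ ()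
Unique-++⁻ (x ∷ xs) (x≢ ∷ xs++ys!) with xs! , ys! , apart ← Unique-++⁻ xs xs++ys! =
  Allₚ.++⁻ˡ xs x≢ ∷ xs! , ys! ,
  λ { v∈ (here refl) → All.lookup (Allₚ.++⁻ʳ xs x≢) v∈ refl ; v∈ (there v∈xs) → apart v∈ v∈xs }

Unique-resp-⊒ : xs ⊑ ys → Unique ys → Unique xs
Unique-resp-⊒ []          []         = []
Unique-resp-⊒ (y ∷ʳ p)    (_ ∷ ys!)  = Unique-resp-⊒ p ys!
Unique-resp-⊒ (refl ∷ p)  (y≢ ∷ ys!) = Sublist.All-resp-⊆ p y≢ ∷ Unique-resp-⊒ p ys!

same-elements : Unique xs → Unique ys → (∀ {x} → x ∈ xs → x ∈ ys) → (∀ {x} → x ∈ ys → x ∈ xs) → xs ↭ ys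
same-elements xs! ys! to from = ∼bag⇒↭ (unique∧set⇒bag xs! ys! (mk⇔ to from))

∈⇒↭ : x ∈ xs → ∃ λ ys → xs ↭ x ∷ ys
∈⇒↭ {x = x} x∈ with as , bs , refl ← ∈-∃++ x∈ = as ++ bs , Permₚ.shift x as bs

∉⇒All≢ : x ∉ xs → All (x ≢_) xs
∉⇒All≢ x∉ = All.tabulate λ { y∈ refl → x∉ y∈ }

-- Two-colourings as 0-1 functions, and vertices rich in both colours.

record TwoColouring (A : Set) : Set where
  field
    red blue : A → A → ℕ
    red-sym  : Symmetric red
    blue-sym : Symmetric blue
    loopless : ∀ x → red x x + blue x x ≡ 0
    bounded  : ∀ x y → red x y + blue x y ≤ 1
    total    : ∀ {x y} → x ≢ y → red x y + blue x y ≡ 1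

  red≤1 : ∀ x y → red x y ≤ 1
  red≤1 x y = ≤-trans (m≤m+n _ _) (bounded x y)

  blue≤1 : ∀ x y → blue x y ≤ 1
  blue≤1 x y = ≤-trans (m≤n+m _ _) (bounded x y)

  red-irr : ∀ x → red x x ≡ 0
  red-irr x = m+n≡0⇒m≡0 (red x x) (loopless x)

swapColours : TwoColouring A → TwoColouring A
swapColours K = record
  { red = blue ; blue = red ; red-sym = blue-sym ; blue-sym = red-sym
  ; loopless = λ x → trans (+-comm (blue x x) (red x x)) (loopless x)
  ; bounded  = λ x y → ≤-trans (≤-reflexive (+-comm (blue x y) (red x y))) (bounded x y)
  ; total    = λ {x} {y} x≢y → trans (+-comm (blue x y) (red x y)) (total x≢y)
  } where open TwoColouring K

-- Every edge meeting `Y` is charged to an end in `Y`, at most `b` for each vertex there. The edges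
-- inside `X` number at most |X|(|X| - 1)/2, which is at most b|X| as |X| ≤ 2b + 1.
low-degrees⇒few : ∀ {k : A → A → ℕ} → Symmetric k → (∀ x y → k x y ≤ 1) → ∀ X Y b →
                  (∀ {y} → y ∈ Y → ∑ (k y) (X ++ Y) ≤ b) → length X ≤ suc (2 * b) →
                  ∑₂ k (X ++ Y) ≤ b * length (X ++ Y)
low-degrees⇒few {k = k} s k≤1 X Y b deg≤b X≤ = begin
  ∑₂ k (X ++ Y)                                              ≡⟨ ∑₂-++ k X Y ⟩
  ∑₂ k X + ∑ (λ x → ∑ (k x) Y) X + ∑₂ k Y                    ≡⟨ +-assoc (∑₂ k X) _ _ ⟩
  ∑₂ k X + (∑ (λ x → ∑ (k x) Y) X + ∑₂ k Y)                  ≤⟨ +-mono-≤ inside outside ⟩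
  length X * b + length Y * b                                ≡⟨ *-distribʳ-+ b (length X) (length Y) ⟨
  (length X + length Y) * b                                  ≡⟨ *-comm _ b ⟩
  b * (length X + length Y)                                  ≡⟨ cong (b *_) (length-++ X) ⟨
  b * length (X ++ Y)                                        ∎
  where
  open ≤-Reasoning
  shuffle : ∀ n b → n * (2 * b) ≡ 2 * (n * b)
  shuffle = solve-∀
  inside : ∑₂ k X ≤ length X * b
  inside = *-cancelˡ-≤ 2 (begin
    2 * ∑₂ k X                  ≤⟨ 2∑₂≤ k≤1 X ⟩
    length X * (length X ∸ 1)   ≤⟨ *-monoʳ-≤ (length X) (∸-monoˡ-≤ 1 X≤) ⟩
    length X * (2 * b)          ≡⟨ shuffle (length X) b ⟩
    2 * (length X * b)          ∎)
  outside : ∑ (λ x → ∑ (k x) Y) X + ∑₂ k Y ≤ length Y * b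
  outside = begin
    ∑ (λ x → ∑ (k x) Y) X + ∑₂ k Y                          ≡⟨ cong (_+ ∑₂ k Y) (∑-swap k X Y) ⟩
    ∑ (λ y → ∑ (λ x → k x y) X) Y + ∑₂ k Y                  ≤⟨ +-mono-≤ (≤-reflexive (∑-cong Y λ {y} _ → ∑-cong X λ {x} _ → s x y)) (∑₂≤∑∑ k Y) ⟩
    ∑ (λ y → ∑ (k y) X) Y + ∑ (λ y → ∑ (k y) Y) Y           ≡⟨ ∑-+ _ _ Y ⟨
    ∑ (λ y → ∑ (k y) X + ∑ (k y) Y) Y                       ≡⟨ ∑-cong Y (λ {y} _ → sym (∑-++ (k y) X)) ⟩
    ∑ (λ y → ∑ (k y) (X ++ Y)) Y                            ≤⟨ ∑-bounded Y deg≤b ⟩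
    length Y * b                                            ∎

-- If no such vertex exists, the list splits into X, of red degree at most ρ,
-- and Y, of blue degree at most β.  Both colours being dense forces
-- |X| ≥ 2β + 2 and |Y| ≥ 2ρ + 2, while counting the pairs between X and Y
-- gives |X||Y| ≤ ρ|X| + β|Y|.
rich-vertex : ∀ (K : TwoColouring A) → let open TwoColouring K in ∀ O ρ β →
              ρ * length O < ∑₂ red O → β * length O < ∑₂ blue O →
              ∃ λ p → p ∈ O × ρ < ∑ (red p) O × β < ∑ (blue p) O
rich-vertex K O ρ β dense-red dense-blue
  with any? (λ p → (suc ρ ≤? ∑ (red p) O) ×-dec (suc β ≤? ∑ (blue p) O)) O
  where open TwoColouring K
... | yes q = find q
... | no ¬q = contradiction count (<⇒≱ too-many)
  where
  open TwoColouring K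
  few? : Decidable (λ p → ∑ (red p) O ≤ ρ)
  few? p = ∑ (red p) O ≤? ρ
  X = filter few? O
  Y = filter (¬? ∘ few?) O
  O↭ : O ↭ X ++ Y
  O↭ = filter-split few? O
  ∣O∣≡ : length O ≡ length (X ++ Y)
  ∣O∣≡ = Permₚ.↭-length O↭
  X-low : ∀ {x} → x ∈ X → ∑ (red x) (X ++ Y) ≤ ρ
  X-low {x} x∈ = ≤-trans (≤-reflexive (∑-↭ _ (↭-sym O↭))) (proj₂ (∈-filter⁻ few? {xs = O} x∈))
  -- A vertex of `Y` has red degree above `ρ`; since it is not rich, its blue degree is the small
  -- one.
  Y-low : ∀ {y} → y ∈ Y → ∑ (blue y) (X ++ Y) ≤ β
  Y-low {y} y∈ with y∈O , ¬few ← ∈-filter⁻ (¬? ∘ few?) {xs = O} y∈ =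
    ≤-trans (≤-reflexive (∑-↭ _ (↭-sym O↭)))
            (≮⇒≥ λ b< → ¬q (lose y∈O (≰⇒> ¬few , b<)))
  X≢Y : ∀ {x y} → x ∈ X → y ∈ Y → x ≢ y
  X≢Y x∈ y∈ refl = proj₂ (∈-filter⁻ (¬? ∘ few?) {xs = O} y∈) (proj₂ (∈-filter⁻ few? {xs = O} x∈))
  -- The colours cross over: `X` is defined by red degrees, but it is the low blue degrees of `Y`
  -- that leave too few blue edges if `X` is small.
  X-big : 2 + 2 * β ≤ length X
  X-big = ≰⇒> λ X≤ → <⇒≱ dense-blue (begin
    ∑₂ blue O            ≡⟨ ∑₂-↭ blue-sym O↭ ⟩
    ∑₂ blue (X ++ Y)     ≤⟨ low-degrees⇒few blue-sym blue≤1 X Y β Y-low X≤ ⟩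
    β * length (X ++ Y)  ≡⟨ cong (β *_) ∣O∣≡ ⟨
    β * length O         ∎)
    where open ≤-Reasoning
  Y-big : 2 + 2 * ρ ≤ length Y
  Y-big = ≰⇒> λ Y≤ → <⇒≱ dense-red (begin
    ∑₂ red O            ≡⟨ ∑₂-↭ red-sym O↭YX ⟩
    ∑₂ red (Y ++ X)     ≤⟨ low-degrees⇒few red-sym red≤1 Y X ρ
                             (λ x∈ → ≤-trans (≤-reflexive (∑-↭ _ (Permₚ.++-comm Y X))) (X-low x∈)) Y≤ ⟩
    ρ * length (Y ++ X) ≡⟨ cong (ρ *_) (Permₚ.↭-length O↭YX) ⟨
    ρ * length O        ∎)
    where
    open ≤-Reasoning
    O↭YX : O ↭ Y ++ X
    O↭YX = ↭-trans O↭ (Permₚ.++-comm X Y)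
  -- Each pair between `X` and `Y` has exactly one colour; red pairs are charged to `X` and blue
  -- pairs to `Y`.
  count : length X * length Y ≤ length X * ρ + length Y * β
  count = begin
    length X * length Y                                              ≡⟨ cong (length X *_) (*-identityʳ (length Y)) ⟨
    length X * (length Y * 1)                                        ≡⟨ ∑-const _ X ⟨
    ∑ (λ _ → length Y * 1) X                                         ≡⟨ ∑-cong X (λ {x} x∈ → trans (sym (∑-const 1 Y))
                                                                         (trans (∑-cong Y λ y∈ → sym (total (X≢Y x∈ y∈))) (∑-+ (red x) (blue x) Y))) ⟩
    ∑ (λ x → ∑ (red x) Y + ∑ (blue x) Y) X                           ≡⟨ ∑-+ _ _ X ⟩
    ∑ (λ x → ∑ (red x) Y) X + ∑ (λ x → ∑ (blue x) Y) X               ≡⟨ cong (∑ (λ x → ∑ (red x) Y) X +_) (trans (∑-swap blue X Y)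
                                                                         (∑-cong Y λ {y} _ → ∑-cong X λ {x} _ → blue-sym x y)) ⟩
    ∑ (λ x → ∑ (red x) Y) X + ∑ (λ y → ∑ (blue y) X) Y               ≤⟨ +-mono-≤
        (∑-bounded X λ {x} x∈ → ≤-trans (≤-trans (m≤n+m _ (∑ (red x) X)) (≤-reflexive (sym (∑-++ (red x) X)))) (X-low x∈))
        (∑-bounded Y λ {y} y∈ → ≤-trans (≤-trans (m≤m+n (∑ (blue y) X) _) (≤-reflexive (sym (∑-++ (blue y) X)))) (Y-low y∈)) ⟩
    length X * ρ + length Y * β                                      ∎
    where open ≤-Reasoning
  -- By the two size bounds, 2|X||Y| is at least 2(ρ|X| + β|Y|) + 2|X| + 2|Y|; strictness comes from
  -- `X` being non-empty.
  too-many : length X * ρ + length Y * β < length X * length Y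
  too-many = *-cancelˡ-< 2 _ _ (begin-strict
    2 * (length X * ρ + length Y * β)                         <⟨ m<m+n _ (≤-trans (s≤s z≤n) (≤-trans X-big (m≤m+n (length X) _))) ⟩
    2 * (length X * ρ + length Y * β) + (length X + (length X + 2 * length Y)) ≡⟨ lemma (length X) (length Y) ρ β ⟩
    length X * (2 + 2 * ρ) + (2 + 2 * β) * length Y           ≤⟨ +-mono-≤ (*-monoʳ-≤ (length X) Y-big) (*-monoˡ-≤ (length Y) X-big) ⟩
    length X * length Y + length X * length Y                 ≡⟨ cong (length X * length Y +_) (+-identityʳ _) ⟨
    2 * (length X * length Y)                                 ∎)
    where
    open ≤-Reasoning
    lemma : ∀ x y r b → 2 * (x * r + y * b) + (x + (x + 2 * y)) ≡ x * (2 + 2 * r) + (2 + 2 * b) * y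
    lemma = solve-∀

-- Greedy: an element is kept while its colour is still wanted. A sublist inherits distinctness, and
-- the final `All` later shows that the centre of a broom was not chosen as its own leaf.
choose : ∀ (f g : A → ℕ) → (∀ x → f x + g x ≤ 1) → ∀ xs i j → i ≤ ∑ f xs → j ≤ ∑ g xs →
         ∃ λ ys → ys ⊑ xs × length ys ≡ i + j × ∑ f ys ≡ i × ∑ g ys ≡ j × All (λ y → f y + g y ≡ 1) ys
choose f g b [] zero zero _ _ = [] , [] , refl , refl , refl , []
choose f g b (x ∷ xs) i j i≤ j≤ with f x in fx | g x in gx | b x
choose f g b (x ∷ xs) i j i≤ j≤ | zero | zero | _
  with ys , sub , l , p , q , a ← choose f g b xs i j i≤ j≤ = ys , x ∷ʳ sub , l , p , q , a
choose f g b (x ∷ xs) zero j i≤ j≤ | suc _ | zero | _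
  with ys , sub , l , p , q , a ← choose f g b xs 0 j z≤n j≤ = ys , x ∷ʳ sub , l , p , q , a
choose f g b (x ∷ xs) (suc i) j (s≤s i≤) j≤ | suc zero | zero | _
  with ys , sub , l , p , q , a ← choose f g b xs i j i≤ j≤ =
  x ∷ ys , refl ∷ sub , cong suc l , cong₂ _+_ fx p , cong₂ _+_ gx q , cong₂ _+_ fx gx ∷ a
choose f g b (x ∷ xs) i zero i≤ j≤ | zero | suc _ | _
  with ys , sub , l , p , q , a ← choose f g b xs i 0 i≤ z≤n = ys , x ∷ʳ sub , l , p , q , a
choose f g b (x ∷ xs) i (suc j) i≤ (s≤s j≤) | zero | suc zero | _
  with ys , sub , l , p , q , a ← choose f g b xs i j i≤ j≤ =
  x ∷ ys , refl ∷ sub , trans (cong suc l) (sym (+-suc i j)) , cong₂ _+_ fx p , cong₂ _+_ gx q , cong₂ _+_ fx gx ∷ a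
choose f g b (x ∷ xs) i j i≤ j≤ | suc (suc _) | zero | s≤s ()
choose f g b (x ∷ xs) i j i≤ j≤ | suc zero | suc _ | s≤s ()
choose f g b (x ∷ xs) i j i≤ j≤ | zero | suc (suc _) | s≤s ()

-- Trees, grown by attaching brooms

-- The leaf l is compulsory so that a broom has room for both colours.
data Brush {V : Set} : List V → List (V × V) → Set where
  single : ∀ v → Brush [ v ] []
  pair   : ∀ a b → Brush (b ∷ a ∷ []) [ a , b ]
  broom  : ∀ {vs es} → Brush vs es → ∀ {w} → w ∈ vs → ∀ u l ls →
           Brush (u ∷ (l ∷ ls) ++ vs) ((w , u) ∷ map (u ,_) (l ∷ ls) ++ es)

∑-broom : ∀ {V : Set} (φ : V → V → ℕ) w u ls es →
          ∑ (uncurry φ) ((w , u) ∷ map (u ,_) ls ++ es) ≡ φ w u + (∑ (φ u) ls + ∑ (uncurry φ) es)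
∑-broom φ w u ls es = cong (φ w u +_)
  (trans (∑-++ (uncurry φ) (map (u ,_) ls)) (cong (_+ ∑ (uncurry φ) es) (∑-map (uncurry φ) (u ,_) ls)))

-- A leaf at the last centre joins its broom, and one deeper down is added recursively. If `p` is
-- itself a leaf of the last broom, it becomes the centre of a new broom with the one leaf `x`.
-- Vertices may be reordered and edges reversed on the way, hence the permutation and the symmetric
-- weights.
add-leaf : ∀ {V : Set} {vs : List V} {es} → Brush vs es → ∀ {p} → p ∈ vs → ∀ x →
           ∃₂ λ vs′ es′ → Brush vs′ es′ × vs′ ↭ x ∷ vs ×
             (∀ {φ} → Symmetric φ → ∑ (uncurry φ) es′ ≡ φ p x + ∑ (uncurry φ) es)
add-leaf (single v) (here refl) x = _ , _ , pair v x , ↭-refl , λ _ → refl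
add-leaf (pair a b) (here refl) x =
  _ , _ , broom (single a) (here refl) b x [] , swap b x ↭-refl ,
  λ {φ} s → lemma (φ a b) (φ b x)
  where
  lemma : ∀ c d → c + (d + 0) ≡ d + (c + 0)
  lemma = solve-∀
-- The path is b-a-x with centre `a`, so the old edge is now recorded as running from `b` to `a`;
-- symmetry of `φ` absorbs the reversal.
add-leaf (pair a b) (there (here refl)) x =
  _ , _ , broom (single b) (here refl) a x [] ,
  ↭-trans (swap a x ↭-refl) (prep x (swap a b ↭-refl)) ,
  λ {φ} s → trans (cong (_+ (φ a x + 0)) (s b a)) (lemma (φ a b) (φ a x))
  where
  lemma : ∀ c d → c + (d + 0) ≡ d + (c + 0)
  lemma = solve-∀
add-leaf (broom t {w} w∈ u l ls) (here refl) x =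
  _ , _ , broom t w∈ u x (l ∷ ls) , swap u x ↭-refl ,
  λ {φ} s → lemma (φ w u) (φ u x) _
  where
  lemma : ∀ c d e → c + (d + e) ≡ d + (c + e)
  lemma = solve-∀
add-leaf (broom {vs} {es} t {w} w∈ u l ls) {p} (there p∈) x with ∈-++⁻ (l ∷ ls) p∈
... | inj₂ p∈vs
  with vs₁ , es₁ , t₁ , vs₁↭ , ∑₁ ← add-leaf t p∈vs x =
  _ , _ , broom t₁ (Permₚ.∈-resp-↭ (↭-sym vs₁↭) (there w∈)) u l ls ,
  ↭-trans (Permₚ.++⁺ˡ (u ∷ l ∷ ls) vs₁↭) (Permₚ.shift x (u ∷ l ∷ ls) vs) ,
  λ {φ} s → begin
    ∑ (uncurry φ) ((w , u) ∷ map (u ,_) (l ∷ ls) ++ es₁)          ≡⟨ ∑-broom φ w u (l ∷ ls) es₁ ⟩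
    φ w u + (∑ (φ u) (l ∷ ls) + ∑ (uncurry φ) es₁)                ≡⟨ cong (λ e → φ w u + (∑ (φ u) (l ∷ ls) + e)) (∑₁ s) ⟩
    φ w u + (∑ (φ u) (l ∷ ls) + (φ p x + ∑ (uncurry φ) es))       ≡⟨ lemma (φ w u) (∑ (φ u) (l ∷ ls)) (φ p x) _ ⟩
    φ p x + (φ w u + (∑ (φ u) (l ∷ ls) + ∑ (uncurry φ) es))       ≡⟨ cong (φ p x +_) (∑-broom φ w u (l ∷ ls) es) ⟨
    φ p x + ∑ (uncurry φ) ((w , u) ∷ map (u ,_) (l ∷ ls) ++ es)   ∎
  where
  open ≡-Reasoning
  lemma : ∀ a b c d → a + (b + (c + d)) ≡ c + (a + (b + d))
  lemma = solve-∀
... | inj₁ p∈ls with ∈⇒↭ p∈ls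
-- Here `p` was the only leaf of `u`. Once `p` becomes a centre, `u` would head a broom without
-- leaves, so `u` is first demoted to a leaf of the inner brush.
add-leaf (broom {vs} {es} t {w} w∈ u l ls) {p} (there p∈) x | inj₁ p∈ls | [] , ls↭
  with vs₁ , es₁ , t₁ , vs₁↭ , ∑₁ ← add-leaf t w∈ u =
  _ , _ , broom t₁ (Permₚ.∈-resp-↭ (↭-sym vs₁↭) (here refl)) p x [] ,
  (let open Perm.PermutationReasoning in begin
    p ∷ x ∷ vs₁            ↭⟨ swap p x vs₁↭ ⟩
    x ∷ p ∷ u ∷ vs         ↭⟨ prep x (swap p u ↭-refl) ⟩
    x ∷ u ∷ p ∷ vs         ↭⟨ prep x (prep u (Permₚ.++⁺ʳ vs ls↭)) ⟨
    x ∷ u ∷ (l ∷ ls) ++ vs ∎) ,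
  λ {φ} s → let open ≡-Reasoning in begin
    φ u p + (φ p x + ∑ (uncurry φ) es₁)                      ≡⟨ cong (λ e → φ u p + (φ p x + e)) (∑₁ s) ⟩
    φ u p + (φ p x + (φ w u + ∑ (uncurry φ) es))             ≡⟨ lemma (φ u p) (φ p x) (φ w u) _ ⟩
    φ p x + (φ w u + ((φ u p + 0) + ∑ (uncurry φ) es))       ≡⟨ cong (λ e → φ p x + (φ w u + (e + ∑ (uncurry φ) es))) (∑-↭ (φ u) ls↭) ⟨
    φ p x + (φ w u + (∑ (φ u) (l ∷ ls) + ∑ (uncurry φ) es))  ≡⟨ cong (φ p x +_) (∑-broom φ w u (l ∷ ls) es) ⟨
    _                                                        ∎
  where
  lemma : ∀ a b c d → a + (b + (c + d)) ≡ b + (c + ((a + 0) + d))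
  lemma = solve-∀
add-leaf (broom {vs} {es} t {w} w∈ u l ls) {p} (there p∈) x | inj₁ p∈ls | l′ ∷ ls′ , ls↭ =
  _ , _ , broom (broom t w∈ u l′ ls′) (here refl) p x [] ,
  (let open Perm.PermutationReasoning in begin
    p ∷ x ∷ u ∷ (l′ ∷ ls′) ++ vs   ↭⟨ swap p x ↭-refl ⟩
    x ∷ p ∷ u ∷ (l′ ∷ ls′) ++ vs   ↭⟨ prep x (swap p u ↭-refl) ⟩
    x ∷ u ∷ p ∷ (l′ ∷ ls′) ++ vs   ↭⟨ prep x (prep u (Permₚ.++⁺ʳ vs ls↭)) ⟨
    x ∷ u ∷ (l ∷ ls) ++ vs         ∎) ,
  λ {φ} s → let open ≡-Reasoning in begin
    φ u p + (φ p x + ∑ (uncurry φ) ((w , u) ∷ map (u ,_) (l′ ∷ ls′) ++ es))    ≡⟨ cong (λ e → φ u p + (φ p x + e)) (∑-broom φ w u (l′ ∷ ls′) es) ⟩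
    φ u p + (φ p x + (φ w u + (∑ (φ u) (l′ ∷ ls′) + ∑ (uncurry φ) es)))        ≡⟨ lemma (φ u p) (φ p x) (φ w u) (∑ (φ u) (l′ ∷ ls′)) _ ⟩
    φ p x + (φ w u + (∑ (φ u) (p ∷ l′ ∷ ls′) + ∑ (uncurry φ) es))              ≡⟨ cong (λ e → φ p x + (φ w u + (e + ∑ (uncurry φ) es))) (∑-↭ (φ u) ls↭) ⟨
    φ p x + (φ w u + (∑ (φ u) (l ∷ ls) + ∑ (uncurry φ) es))                    ≡⟨ cong (φ p x +_) (∑-broom φ w u (l ∷ ls) es) ⟨
    _                                                                          ∎
  where
  lemma : ∀ a b c d e → a + (b + (c + (d + e))) ≡ b + (c + ((a + d) + e))
  lemma = solve-∀

endpoints : ∀ {V : Set} {vs : List V} {es} → Brush vs es →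
            ∀ {a b} → (a , b) ∈ es → a ∈ vs × b ∈ vs
endpoints (pair a b) (here refl) = there (here refl) , here refl
endpoints (broom t w∈ u l ls) (here refl) = there (∈-++⁺ʳ (l ∷ ls) w∈) , here refl
endpoints (broom t w∈ u l ls) (there e∈) with ∈-++⁻ (map (u ,_) (l ∷ ls)) e∈
... | inj₁ e∈ls with _ , v∈ , refl ← ∈-map⁻ (u ,_) e∈ls = here refl , there (∈-++⁺ˡ v∈)
... | inj₂ e∈es with a∈ , b∈ ← endpoints t e∈es = there (∈-++⁺ʳ (l ∷ ls) a∈) , there (∈-++⁺ʳ (l ∷ ls) b∈)

brush-size : ∀ {V : Set} {vs : List V} {es} → Brush vs es → length vs ≡ suc (length es)
brush-size (single v) = refl
brush-size (pair a b) = refl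
brush-size (broom {vs} {es} t w∈ u l ls) = cong (2 +_) (begin
  length (ls ++ vs)                          ≡⟨ length-++ ls ⟩
  length ls + length vs                      ≡⟨ cong (length ls +_) (brush-size t) ⟩
  length ls + suc (length es)                ≡⟨ +-suc (length ls) (length es) ⟩
  suc (length ls + length es)                ≡⟨ cong (λ i → suc (i + length es)) (length-map (u ,_) ls) ⟨
  suc (length (map (u ,_) ls) + length es)   ≡⟨ cong suc (length-++ (map (u ,_) ls)) ⟨
  suc (length (map (u ,_) ls ++ es))         ∎)
  where open ≡-Reasoning

-- Embeddings into a two-coloured vertex set

_∈?_ : ∀ {n} (x : Fin n) xs → Dec (x ∈ xs)
_∈?_ = DecMembership._∈?_ _≟_

-- Only the values of `embed` on `vs` matter. As the function is total, a copy is enlarged by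
-- overriding it on the new vertices.
record Embedding {m n} (K : TwoColouring (Fin n)) (U : List (Fin n))
                 (vs : List (Fin m)) (es : List (Fin m × Fin m)) (r b : ℕ) : Set where
  open TwoColouring K
  field
    embed      : Fin m → Fin n
    distinct   : Unique (map embed vs)
    inside     : ∀ {v} → v ∈ vs → embed v ∈ U
    red-count  : ∑ (uncurry λ u v → red (embed u) (embed v)) es ≡ r
    blue-count : ∑ (uncurry λ u v → blue (embed u) (embed v)) es ≡ b

  image outside : List (Fin n)
  image   = map embed vs
  outside = filter (λ x → ¬? (x ∈? image)) U

  outside⇒U : ∀ {x} → x ∈ outside → x ∈ U
  outside⇒U x∈ = proj₁ (∈-filter⁻ _ {xs = U} x∈)

  outside⇒∉ : ∀ {x} → x ∈ outside → x ∉ image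
  outside⇒∉ x∈ = proj₂ (∈-filter⁻ (λ x → ¬? (x ∈? image)) {xs = U} x∈)

  image⇒U : ∀ {x} → x ∈ image → x ∈ U
  image⇒U x∈ with _ , v∈ , refl ← ∈-map⁻ embed x∈ = inside v∈

  partition : Unique U → U ↭ image ++ outside
  partition U! = ↭-trans (filter-split (_∈? image) U)
    (Permₚ.++⁺ʳ outside (same-elements (Uniqueₚ.filter⁺ (_∈? image) U!) distinct
      (λ x∈ → proj₂ (∈-filter⁻ (_∈? image) {xs = U} x∈))
      (λ x∈ → ∈-filter⁺ (_∈? image) (image⇒U x∈) x∈)))

redefine : ∀ {m} (f : Fin m → C) as xs → length xs ≡ length as → Unique as →
           ∃ λ f′ → map f′ as ≡ xs × (∀ {v} → v ∉ as → f′ v ≡ f v)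
redefine f [] [] eq [] = f , refl , λ _ → refl
redefine {C = C} {m} f (a ∷ as) (x ∷ xs) eq (a≢as ∷ as!)
  with f′ , on , off ← redefine f as xs (suc-injective eq) as! =
  f″ , cong₂ _∷_ at-a (trans (map-cong-local (All.map off-a a≢as)) on) ,
  λ v∉ → trans (off-a (v∉ ∘ here ∘ sym)) (off (v∉ ∘ there))
  where
  f″ : Fin m → C
  f″ v with v ≟ a
  ... | yes _ = x
  ... | no  _ = f′ v
  at-a : f″ a ≡ x
  at-a with a ≟ a
  ... | yes _  = refl
  ... | no a≢a = contradiction refl a≢a
  off-a : ∀ {v} → a ≢ v → f″ v ≡ f′ v
  off-a {v} a≢v with v ≟ a
  ... | yes v≡a = contradiction (sym v≡a) a≢v
  ... | no  _   = refl

-- The centre `u` goes to `p` and the leaves go to `i` red and `j` blue neighbours of `p` outside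
-- the copy. The colour of the edge from the image of `w` to `p` stays open and enters the counts as
-- an indicator, to be resolved by the caller.
graft : ∀ {m n} {K : TwoColouring (Fin n)} {U vs} {es : List (Fin m × Fin m)} {r b} →
        Unique U → (E : Embedding K U vs es r b) →
        let open Embedding E
            open TwoColouring K in
        Brush vs es → ∀ {w} → w ∈ vs → ∀ u ls → Unique (u ∷ ls ++ vs) →
        ∀ {p} → p ∈ outside → ∀ i j → i + j ≡ length ls →
        i ≤ ∑ (red p) outside → j ≤ ∑ (blue p) outside →
        Embedding K U (u ∷ ls ++ vs) ((w , u) ∷ map (u ,_) ls ++ es)
                  (red (embed w) p + (i + r)) (blue (embed w) p + (j + b))
graft {m} {n} {K} {U} {vs} {es} {r} {b} U! E t {w} w∈ u ls vs′! {p} p∈ i j i+j≡ i≤ j≤ =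
  let qs , qs⊑ , ∣qs∣≡ , red-qs , blue-qs , coloured =
        choose (red p) (blue p) (bounded p) outside i j i≤ j≤
      f′ , on , off = redefine embed (u ∷ ls) (p ∷ qs) (cong suc (trans ∣qs∣≡ i+j≡)) (proj₁ (Unique-++⁻ (u ∷ ls) vs′!))
  in extend qs⊑ coloured red-qs blue-qs f′ on off
  where
  open Embedding E
  open TwoColouring K
  fresh : ∀ {v} → v ∈ vs → v ∉ u ∷ ls
  fresh = proj₂ (proj₂ (Unique-++⁻ (u ∷ ls) vs′!))
  extend : ∀ {qs} → qs ⊑ outside → All (λ q → red p q + blue p q ≡ 1) qs →
           ∑ (red p) qs ≡ i → ∑ (blue p) qs ≡ j →
           ∀ f′ → map f′ (u ∷ ls) ≡ p ∷ qs → (∀ {v} → v ∉ u ∷ ls → f′ v ≡ embed v) →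
           Embedding K U (u ∷ ls ++ vs) ((w , u) ∷ map (u ,_) ls ++ es)
                     (red (embed w) p + (i + r)) (blue (embed w) p + (j + b))
  extend {qs} qs⊑ coloured red-qs blue-qs f′ on off = record
    { embed      = f′
    ; distinct   = subst Unique (sym image′) (Uniqueₚ.++⁺ (∉⇒All≢ p∉ ∷ Unique-resp-⊒ qs⊑ (Uniqueₚ.filter⁺ _ U!)) distinct
                     λ { (x∈ , x∈image) → outside⇒∉ (new-outside x∈) x∈image })
    ; inside     = λ {v} v∈ → image′⇒U (subst (f′ v ∈_) image′ (∈-map⁺ f′ v∈))
    ; red-count  = trans (count red) (cong₂ (λ x y → red (embed w) p + (x + y)) red-qs red-count)
    ; blue-count = trans (count blue) (cong₂ (λ x y → blue (embed w) p + (x + y)) blue-qs blue-count)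
    }
    where
    off-vs : ∀ {v} → v ∈ vs → f′ v ≡ embed v
    off-vs v∈ = off (fresh v∈)
    image′ : map f′ ((u ∷ ls) ++ vs) ≡ (p ∷ qs) ++ image
    image′ = trans (map-++ f′ (u ∷ ls) vs) (cong₂ _++_ on (map-cong-local (All.tabulate off-vs)))
    -- Chosen neighbours have a colour towards `p`, while `p` has none towards itself.
    p∉ : p ∉ qs
    p∉ p∈qs with () ← trans (sym (loopless p)) (All.lookup coloured p∈qs)
    new-outside : ∀ {x} → x ∈ p ∷ qs → x ∈ outside
    new-outside (here refl) = p∈
    new-outside (there x∈)  = ⊑-lookup qs⊑ x∈
    image′⇒U : ∀ {x} → x ∈ (p ∷ qs) ++ image → x ∈ U
    image′⇒U x∈ with ∈-++⁻ (p ∷ qs) x∈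
    ... | inj₁ x∈new   = outside⇒U (new-outside x∈new)
    ... | inj₂ x∈image = image⇒U x∈image
    f′u : f′ u ≡ p
    f′u = ∷-injectiveˡ on
    -- Old edges keep their images: their ends lie in `vs`, where `f′` agrees with `embed`.
    count : ∀ (k : Fin n → Fin n → ℕ) →
            ∑ (uncurry λ a c → k (f′ a) (f′ c)) ((w , u) ∷ map (u ,_) ls ++ es) ≡
            k (embed w) p + (∑ (k p) qs + ∑ (uncurry λ a c → k (embed a) (embed c)) es)
    count k = trans (∑-broom (λ a c → k (f′ a) (f′ c)) w u ls es)
      (cong₂ _+_ (cong₂ k (off-vs w∈) f′u)
        (cong₂ _+_ (begin
            ∑ (λ c → k (f′ u) (f′ c)) ls  ≡⟨ cong (λ x → ∑ (λ c → k x (f′ c)) ls) f′u ⟩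
            ∑ (λ c → k p (f′ c)) ls       ≡⟨ ∑-map (k p) f′ ls ⟨
            ∑ (k p) (map f′ ls)           ≡⟨ cong (∑ (k p)) (∷-injectiveʳ on) ⟩
            ∑ (k p) qs                    ∎)
          (∑-cong es λ e∈ → let a∈ , c∈ = endpoints t e∈ in cong₂ k (off-vs a∈) (off-vs c∈))))
      where open ≡-Reasoning

-- Copies in one colour.

-- Deleting a vertex of degree below D costs at most D − 1 edges.
dense⇒core : ∀ {k : A → A → ℕ} → Symmetric k → ∀ D N U → length U ≤ N → Unique U →
             (D ∸ 1) * length U < ∑₂ k U →
             ∃ λ W → (∀ {x} → x ∈ W → x ∈ U) × Unique W × (∃ λ x → x ∈ W) ×
                     (∀ {x} → x ∈ W → D ≤ ∑ (k x) W)
dense⇒core {k = k} s D N U U≤N U! dense with any? (λ x → suc (∑ (k x) U) ≤? D) U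
-- The strict density inequality fails for the empty list; this is what guarantees a vertex in the
-- core.
dense⇒core s D N [] U≤N U! dense | no _ = contradiction dense λ ()
dense⇒core s D N U@(x ∷ _) U≤N U! dense | no ¬q =
  U , (λ x∈ → x∈) , U! , (x , here refl) , λ y∈ → ≮⇒≥ λ low → ¬q (lose y∈ low)
dense⇒core {k = k} s D N U U≤N U! dense | yes q
  with x , x∈ , low ← find q
  with V , U↭ ← ∈⇒↭ x∈
  -- `N` is the recursion measure, since `V` is not a structural part of `U`.
  with N | ≤-trans (≤-reflexive (sym (Permₚ.↭-length U↭))) U≤N | Unique-resp-↭ U↭ U!
... | suc N′ | s≤s V≤ | _ ∷ V!
  with W , W⊆ , rest ← dense⇒core s D N′ V V≤ V! (+-cancelˡ-< (D ∸ 1) _ _ (let open ≤-Reasoning in begin-strict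
    D ∸ 1 + (D ∸ 1) * length V     ≡⟨ *-suc (D ∸ 1) (length V) ⟨
    (D ∸ 1) * suc (length V)       ≡⟨ cong ((D ∸ 1) *_) (Permₚ.↭-length U↭) ⟨
    (D ∸ 1) * length U             <⟨ dense ⟩
    ∑₂ k U                         ≡⟨ ∑₂-↭ s U↭ ⟩
    ∑ (k x) V + ∑₂ k V             ≤⟨ +-monoˡ-≤ (∑₂ k V) (begin
      ∑ (k x) V                      ≤⟨ m≤n+m _ (k x x) ⟩
      ∑ (k x) (x ∷ V)                ≡⟨ ∑-↭ (k x) U↭ ⟨
      ∑ (k x) U                      ≤⟨ ∸-monoˡ-≤ 1 low ⟩
      D ∸ 1                          ∎) ⟩
    D ∸ 1 + ∑₂ k V                 ∎))
  = W , (λ y∈ → Permₚ.∈-resp-↭ (↭-sym U↭) (there (W⊆ y∈))) , rest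

broom-size : ∀ {V : Set} (w u : V) ls es → length ((w , u) ∷ map (u ,_) ls ++ es) ≡ suc (length ls + length es)
broom-size w u ls es = cong suc (trans (length-++ (map (u ,_) ls)) (cong (_+ length es) (length-map (u ,_) ls)))

module _ {m n : ℕ} {K : TwoColouring (Fin n)} {W : List (Fin n)} where
  open TwoColouring K

  embed-single : ∀ {x} → x ∈ W → (v : Fin m) → Embedding K W [ v ] [] 0 0
  embed-single {x} x∈ v = record
    { embed = λ _ → x ; distinct = [] ∷ [] ; inside = λ _ → x∈ ; red-count = refl ; blue-count = refl }

  -- The copy has |es| + 1 vertices. The image of `w` has at most |es| red neighbours among them, so
  -- one is left outside to serve as `p`; this `p` has at most |es| + 1 there, so at least |ls| are
  -- left for the leaves.
  extend-red : ∀ {vs} {es : List (Fin m × Fin m)} → Unique W →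
               Embedding K W vs es (length es) 0 → Brush vs es → ∀ {w} → w ∈ vs →
               ∀ u ls → Unique (u ∷ ls ++ vs) →
               (∀ {x} → x ∈ W → suc (length ls + length es) ≤ ∑ (red x) W) →
               Embedding K W (u ∷ ls ++ vs) ((w , u) ∷ map (u ,_) ls ++ es)
                         (length ((w , u) ∷ map (u ,_) ls ++ es)) 0
  extend-red {vs} {es} W! E t {w} w∈ u ls vs′! deg
    = attach (∑-positive room-w)
    where
    open Embedding E
    ∣image∣ : length image ≡ suc (length es)
    ∣image∣ = trans (length-map embed vs) (brush-size t)
    split : ∀ x → ∑ (red x) W ≡ ∑ (red x) image + ∑ (red x) outside
    split x = trans (∑-↭ (red x) (partition W!)) (∑-++ (red x) image)
    -- When `ls` is empty the degree bound is only |es| + 1, so it matters that the image of `w` is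
    -- removed from its own possible neighbours.
    room-w : 1 ≤ ∑ (red (embed w)) outside
    room-w with I , image↭ ← ∈⇒↭ (∈-map⁺ embed w∈) = +-cancelˡ-≤ (length es) _ _ (begin
      length es + 1                             ≡⟨ +-comm (length es) 1 ⟩
      suc (length es)                           ≤⟨ s≤s (m≤n+m _ (length ls)) ⟩
      suc (length ls + length es)               ≤⟨ deg (inside w∈) ⟩
      ∑ (red z) W                               ≡⟨ split z ⟩
      ∑ (red z) image + ∑ (red z) outside       ≡⟨ cong (_+ ∑ (red z) outside) (trans (∑-↭ (red z) image↭) (cong (_+ ∑ (red z) I) (red-irr z))) ⟩
      ∑ (red z) I + ∑ (red z) outside           ≤⟨ +-monoˡ-≤ _ (∑-bounded I λ {y} _ → red≤1 z y) ⟩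
      length I * 1 + ∑ (red z) outside          ≡⟨ cong (_+ ∑ (red z) outside) (trans (*-identityʳ _)
                                                     (suc-injective (trans (sym (Permₚ.↭-length image↭)) ∣image∣))) ⟩
      length es + ∑ (red z) outside             ∎)
      where
      open ≤-Reasoning
      z = embed w
    room-p : ∀ {p} → p ∈ outside → length ls ≤ ∑ (red p) outside
    room-p {p} p∈ = +-cancelˡ-≤ (suc (length es)) _ _ (begin
      suc (length es + length ls)               ≡⟨ cong suc (+-comm (length es) (length ls)) ⟩
      suc (length ls + length es)               ≤⟨ deg (outside⇒U p∈) ⟩
      ∑ (red p) W                               ≡⟨ split p ⟩
      ∑ (red p) image + ∑ (red p) outside       ≤⟨ +-monoˡ-≤ _ (∑-bounded image λ {y} _ → red≤1 p y) ⟩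
      length image * 1 + ∑ (red p) outside      ≡⟨ cong (_+ ∑ (red p) outside) (trans (*-identityʳ _) ∣image∣) ⟩
      suc (length es) + ∑ (red p) outside       ∎)
      where open ≤-Reasoning
    attach : (∃ λ p → p ∈ outside × 1 ≤ red (embed w) p) → Embedding K W _ _ _ 0
    attach (p , p∈ , wp≥1) = subst₂ (Embedding K W _ _)
      (trans (cong (_+ (length ls + length es)) wp-red) (sym (broom-size w u ls es)))
      (cong (_+ 0) wp-not-blue)
      (graft W! E t w∈ u ls vs′! p∈ (length ls) 0 (+-identityʳ _) (room-p p∈) z≤n)
      where
      wp-red : red (embed w) p ≡ 1
      wp-red = ≤-antisym (red≤1 _ _) wp≥1
      wp-not-blue : blue (embed w) p ≡ 0
      wp-not-blue = n≤0⇒n≡0 (+-cancelˡ-≤ 1 _ _ (subst (λ i → i + blue (embed w) p ≤ 1) wp-red (bounded _ _)))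

  red-copy-in-core : ∀ {vs} {es : List (Fin m × Fin m)} → Unique W → (∃ λ x → x ∈ W) →
                     Brush vs es → Unique vs → (∀ {x} → x ∈ W → length es ≤ ∑ (red x) W) →
                     Embedding K W vs es (length es) 0
  red-copy-in-core W! (x , x∈) (single v) vs! deg = embed-single x∈ v
  -- A pair is treated as a centre `b` hung on `a` with no leaves.
  red-copy-in-core W! (x , x∈) (pair a b) vs! deg =
    extend-red W! (embed-single x∈ a) (single a) (here refl) b [] vs! deg
  red-copy-in-core W! ne (broom {vs} {es} t {w} w∈ u l ls) vs! deg =
    extend-red W! (red-copy-in-core W! ne t (proj₁ (proj₂ (Unique-++⁻ (u ∷ l ∷ ls) vs!)))
                     (λ x∈ → ≤-trans (m≤n+m (length es) (suc (length (l ∷ ls)))) (deg′ x∈)))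
               t w∈ u (l ∷ ls) vs! deg′
    where
    deg′ : ∀ {x} → x ∈ W → suc (length (l ∷ ls) + length es) ≤ ∑ (red x) W
    deg′ x∈ = ≤-trans (≤-reflexive (sym (broom-size w u (l ∷ ls) es))) (deg x∈)

swap-embedding : ∀ {m n} {K : TwoColouring (Fin n)} {U vs} {es : List (Fin m × Fin m)} {r b} →
                 Embedding (swapColours K) U vs es r b → Embedding K U vs es b r
swap-embedding E = record
  { embed = embed ; distinct = distinct ; inside = inside
  ; red-count = blue-count ; blue-count = red-count }
  where open Embedding E

-- With `D` equal to the number of edges of the tree, `dense⇒core` yields a set in which every red
-- degree suffices for the greedy embedding.
red-copy : ∀ {m n} {K : TwoColouring (Fin n)} → let open TwoColouring K in
           ∀ {U vs} {es : List (Fin m × Fin m)} →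
           Unique U → Brush vs es → Unique vs → (length es ∸ 1) * length U < ∑₂ red U →
           Embedding K U vs es (length es) 0
red-copy {K = K} {U} {es = es} U! t vs! dense
  with W , W⊆U , W! , ne , deg ← dense⇒core (TwoColouring.red-sym K) (length es) (length U) U ≤-refl U! dense
  = record { Embedding E ; inside = W⊆U ∘ Embedding.inside E }
  where E = red-copy-in-core {K = K} W! ne t vs! deg

-- Copies in both colours.

share : ∀ k r b → k ≤ r + b →
        ∃₂ λ r₀ ρ → ∃₂ λ b₀ β → r ≡ r₀ + ρ × b ≡ b₀ + β × k ≡ r₀ + b₀
share zero    r       b       k≤       = 0 , r , 0 , b , refl , refl , refl
-- Red is used up first; blue is drawn on only when no red is left.
share (suc k) zero    (suc b) (s≤s k≤)
  with r₀ , ρ , b₀ , β , p , q , s ← share k zero b k≤ =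
  r₀ , ρ , suc b₀ , β , p , cong suc q , trans (cong suc s) (sym (+-suc r₀ b₀))
share (suc k) (suc r) b       (s≤s k≤)
  with r₀ , ρ , b₀ , β , p , q , s ← share k r b k≤ =
  suc r₀ , ρ , b₀ , β , cong suc p , q , cong suc s

one-of : ∀ a b → a + b ≡ 1 → (a ≡ 1 × b ≡ 0) ⊎ (a ≡ 0 × b ≡ 1)
one-of zero       b    eq   = inj₂ (refl , eq)
one-of (suc zero) zero refl = inj₁ (refl , refl)

-- Induction along the brush with the host `U` fixed: a smaller tree asks for less density, so the
-- hypotheses pass to the inner brush. Patterns in one colour go to `red-copy`, with the colours
-- exchanged if necessary.
coloured-copy : ∀ {m n} {K : TwoColouring (Fin n)} → let open TwoColouring K in
                ∀ {U vs} {es : List (Fin m × Fin m)} →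
                Unique U → Brush vs es → Unique vs →
                (length es ∸ 1) * length U < ∑₂ red U → (length es ∸ 1) * length U < ∑₂ blue U →
                ∀ r b → r + b ≡ length es → Embedding K U vs es r b
coloured-copy {K = K} U! t vs! dr db zero _ refl =
  swap-embedding {K = K} (red-copy {K = swapColours K} U! t vs! db)
coloured-copy {K = K} {U} {vs} {es} U! t vs! dr db (suc r) zero eq =
  subst (λ i → Embedding K U vs es i 0) (trans (sym eq) (+-identityʳ (suc r))) (red-copy U! t vs! dr)
coloured-copy U! (pair _ _) vs! dr db (suc r) (suc b) eq = contradiction (trans (sym (+-suc r b)) (suc-injective eq)) λ ()
coloured-copy {K = K} {U} U! (broom {vs} {es} t {w} w∈ u l ls) vs! dr db (suc r) (suc b) eq
  -- One edge of each colour is held back from the division: the edge from `w` to `u` will take one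
  -- of them and a leaf edge the other. The remaining `ρ` and `β` add up to |ls|, two less than the
  -- size of the broom.
  with share (length es) r b (subst (length es ≤_) (sym (suc-injective (suc-injective (trans (cong suc (sym (+-suc r b))) (trans eq (broom-size w u (l ∷ ls) es)))))) (m≤n+m _ (length ls)))
... | r₀ , ρ , b₀ , β , refl , refl , es≡ = attach (rich-vertex K outside ρ β (dense-outside red-sym red≤1 ρ≤ dr) (dense-outside blue-sym blue≤1 β≤ db))
  where
  open TwoColouring K
  size : length ((w , u) ∷ map (u ,_) (l ∷ ls) ++ es) ≡ suc (length (l ∷ ls) + length es)
  size = broom-size w u (l ∷ ls) es
  vs₀! : Unique vs
  vs₀! = proj₁ (proj₂ (Unique-++⁻ (u ∷ l ∷ ls) vs!))
  weaken : ∀ {s} → (length ((w , u) ∷ map (u ,_) (l ∷ ls) ++ es) ∸ 1) * length U < s →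
           (length es ∸ 1) * length U < s
  weaken = ≤-<-trans (*-monoˡ-≤ (length U) (∸-monoˡ-≤ 1 (≤-trans (m≤n+m (length es) _) (≤-reflexive (sym size)))))
  E : Embedding K U vs es r₀ b₀
  E = coloured-copy U! t vs₀! (weaken dr) (weaken db) r₀ b₀ (sym es≡)
  open Embedding E
  ρ+β≡ : ρ + β ≡ length ls
  ρ+β≡ = +-cancelʳ-≡ (length es) _ _ (suc-injective (suc-injective (begin
    2 + (ρ + β + length es)          ≡⟨ cong (λ k → 2 + (ρ + β + k)) es≡ ⟩
    2 + (ρ + β + (r₀ + b₀))          ≡⟨ lemma ρ β r₀ b₀ ⟩
    suc (r₀ + ρ) + suc (b₀ + β)      ≡⟨ trans eq size ⟩
    2 + (length ls + length es)      ∎)))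
    where
    open ≡-Reasoning
    lemma : ∀ c d e f → 2 + (c + d + (e + f)) ≡ suc (e + c) + suc (f + d)
    lemma = solve-∀
  ρ≤ : ρ ≤ length ls
  ρ≤ = ≤-trans (m≤m+n ρ β) (≤-reflexive ρ+β≡)
  β≤ : β ≤ length ls
  β≤ = ≤-trans (m≤n+m β ρ) (≤-reflexive ρ+β≡)
  U↭ : U ↭ image ++ outside
  U↭ = partition U!
  -- More than (1 + |ls| + |es|)|U| edges are present and the copy, with its |es| + 1 vertices,
  -- destroys at most (|es| + 1)|U| of them. More than |ls||U| survive, and `d` is at most |ls|.
  dense-outside : ∀ {k d} → Symmetric k → (∀ x y → k x y ≤ 1) → d ≤ length ls →
                  (length ((w , u) ∷ map (u ,_) (l ∷ ls) ++ es) ∸ 1) * length U < ∑₂ k U →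
                  d * length outside < ∑₂ k outside
  dense-outside {k} {d} s k≤1 d≤ dense = +-cancelˡ-< (suc (length es) * length U) _ _ (begin-strict
    suc (length es) * length U + d * length outside           ≤⟨ +-monoʳ-≤ _ (*-mono-≤ d≤ outside≤) ⟩
    suc (length es) * length U + length ls * length U         ≡⟨ *-distribʳ-+ (length U) (suc (length es)) (length ls) ⟨
    (suc (length es) + length ls) * length U                  ≡⟨ cong (λ i → suc i * length U) (+-comm (length es) (length ls)) ⟩
    suc (length ls + length es) * length U                    ≡⟨ cong (λ i → (i ∸ 1) * length U) size ⟨
    _                                                         <⟨ dense ⟩
    ∑₂ k U                                                    ≡⟨ ∑₂-↭ s U↭ ⟩
    ∑₂ k (image ++ outside)                                   ≤⟨ ∑₂-++-≤ k≤1 image outside ⟩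
    length image * length (image ++ outside) + ∑₂ k outside   ≡⟨ cong (_+ ∑₂ k outside) (cong₂ _*_ (trans (length-map embed vs) (brush-size t)) (sym (Permₚ.↭-length U↭))) ⟩
    suc (length es) * length U + ∑₂ k outside                 ∎)
    where
    open ≤-Reasoning
    outside≤ : length outside ≤ length U
    outside≤ = length-filter _ U
  attach : (∃ λ p → p ∈ outside × ρ < ∑ (red p) outside × β < ∑ (blue p) outside) →
           Embedding K U _ _ (suc (r₀ + ρ)) (suc (b₀ + β))
  attach (p , p∈ , red-p , blue-p)
    -- If this edge is red, the leaves supply `ρ` red and β + 1 blue edges; if it is blue, ρ + 1 red
    -- and `β` blue. The strict bounds at `p` cover both.
    with one-of _ _ (total {embed w} {p} λ { refl → outside⇒∉ p∈ (∈-map⁺ embed w∈) })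
  ... | inj₁ (wp-red , wp-blue) = subst₂ (Embedding K U _ _)
    (trans (cong (_+ (ρ + r₀)) wp-red) (cong suc (+-comm ρ r₀)))
    (trans (cong (_+ (suc β + b₀)) wp-blue) (cong suc (+-comm β b₀)))
    (graft U! E t w∈ u (l ∷ ls) vs! p∈ ρ (suc β) (trans (+-suc ρ β) (cong suc ρ+β≡)) (<⇒≤ red-p) blue-p)
  ... | inj₂ (wp-red , wp-blue) = subst₂ (Embedding K U _ _)
    (trans (cong (_+ (suc ρ + r₀)) wp-red) (cong suc (+-comm ρ r₀)))
    (trans (cong (_+ (β + b₀)) wp-blue) (cong suc (+-comm β b₀)))
    (graft U! E t w∈ u (l ∷ ls) vs! p∈ (suc ρ) β (cong suc ρ+β≡) red-p (<⇒≤ blue-p))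

-- Growing a tree from a graph

ind : Bool → ℕ
ind false = 0
ind true  = 1

ind-yes : ∀ {b} → T b → ind b ≡ 1
ind-yes {true} _ = refl

ind-no : ∀ {b} → ¬ T b → ind b ≡ 0
ind-no {false} _  = refl
ind-no {true}  ¬t = contradiction _ ¬t

ind-cong : ∀ {b c} → (T b → T c) → (T c → T b) → ind b ≡ ind c
ind-cong {false} {c} to from = sym (ind-no from)
ind-cong {true}  {c} to from = sym (ind-yes (to _))

adj-sym : ∀ {n} (G : Graph n) u v → ind (Graph.adj G u v) ≡ ind (Graph.adj G v u)
adj-sym G u v = ind-cong (Graph.symmetric G u v) (Graph.symmetric G v u)

-- Weight 1 gives the edge count of `G`; the colour indicator of the image pair gives the number of
-- edges mapped to that colour.
weigh : ∀ {n} → Graph n → (Fin n → Fin n → ℕ) → Fin n → Fin n → ℕ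
weigh G φ u v = ind (Graph.adj G u v) * φ u v

weigh-sym : ∀ {n} (G : Graph n) {φ} → Symmetric φ → Symmetric (weigh G φ)
weigh-sym G s u v = cong₂ _*_ (adj-sym G u v) (s u v)

-- The list holds the vertices after the first one.
data Walk {n} (G : Graph n) : Fin n → List (Fin n) → Fin n → Set where
  stop : ∀ {a} → Walk G a [] a
  step : ∀ {a b c l} → Adj G a b → Walk G b l c → Walk G a (b ∷ l) c

snoc : ∀ {n} {G : Graph n} {a b y l} → Walk G a l b → Adj G b y → Walk G a (l ++ [ y ]) y
snoc stop       e = step e stop
snoc (step d w) e = step d (snoc w e)

walk-step : ∀ {n} {G : Graph n} {a b l} → Walk G a l b → (i : Fin (length l)) →
            Adj G (lookup (a ∷ l) (inject₁ i)) (lookup l i)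
walk-step (step e w) zero    = e
walk-step (step e w) (suc i) = walk-step w i

walk-end : ∀ {n} {G : Graph n} {a b l} → Walk G a l b → lookup (a ∷ l) (fromℕ (length l)) ≡ b
walk-end stop       = refl
walk-end (step e w) = walk-end w

lookup-injective : Unique xs → Injective _≡_ _≡_ (lookup xs)
lookup-injective (x≢ ∷ xs!) {zero}  {zero}  eq = refl
lookup-injective (x≢ ∷ xs!) {zero}  {suc j} eq = contradiction eq (All.lookup x≢ (∈-lookup j))
lookup-injective (x≢ ∷ xs!) {suc i} {zero}  eq = contradiction (sym eq) (All.lookup x≢ (∈-lookup i))
lookup-injective (x≢ ∷ xs!) {suc i} {suc j} eq = cong suc (lookup-injective xs! eq)

-- The cycle runs from `y` along the walk and back. Since `a ≢ b`, the walk has at least one step,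
-- which provides the third vertex.
close-cycle : ∀ {n} {G : Graph n} {y a b l} → Walk G a l b → Unique (y ∷ a ∷ l) → a ≢ b →
              Adj G y a → Adj G b y → Cycle G
close-cycle stop _ a≢a _ _ = contradiction refl a≢a
close-cycle {G = G} {y} {a} {l = b ∷ l} (step d w) ! _ e e′ = record
  { ℓ        = length l
  ; vertex   = lookup (y ∷ a ∷ b ∷ l)
  ; distinct = lookup-injective !
  ; step     = walk-step (step e (step d w))
  ; close    = subst (λ v → Adj G v y) (sym (walk-end w)) e′
  }

-- `weights` expresses that `es` lists the edges of `G` inside `vs` once each, in a form blind to
-- their order and orientation. `paths` keeps simple paths that stay inside `vs`, from which a
-- second edge to a new vertex would make a cycle.
record Grown {m} (G : Graph m) (vs : List (Fin m)) : Set where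
  field
    es      : List (Fin m × Fin m)
    brush   : Brush vs es
    unique  : Unique vs
    weights : ∀ {φ} → Symmetric φ → ∑₂ (weigh G φ) vs ≡ ∑ (uncurry φ) es
    paths   : ∀ {a b} → a ∈ vs → b ∈ vs →
              ∃ λ l → Walk G a l b × Unique (a ∷ l) × (∀ {v} → v ∈ a ∷ l → v ∈ vs)

-- The new vertex `y` has `p` as its only neighbour in `vs`: another one would be joined to `p` by a
-- simple path avoiding `y`, closing a cycle. So exactly one edge is added.
grow : ∀ {m} {G : Graph m} → ¬ Cycle G → ∀ {vs} → Grown G vs →
       ∀ {p y} → p ∈ vs → Adj G p y → y ∉ vs → ∃ λ vs′ → Grown G vs′ × vs′ ↭ y ∷ vs
grow {G = G} acyclic {vs} gr {p} {y} p∈ py y∉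
  with vs′ , es′ , brush′ , vs′↭ , ∑′ ← add-leaf (Grown.brush gr) p∈ y =
  vs′ , grown , vs′↭
  where
  open Grown gr
  yp : Adj G y p
  yp = Graph.symmetric G p y py
  sole-neighbour : ∀ {v} → v ∈ vs → Adj G y v → v ≡ p
  sole-neighbour {v} v∈ yv with v ≟ p
  ... | yes v≡p = v≡p
  ... | no  v≢p with l , w , l! , l⊆ ← paths p∈ v∈ =
    contradiction (close-cycle w (∉⇒All≢ (y∉ ∘ l⊆) ∷ l!) (v≢p ∘ sym) yp (Graph.symmetric G y v yv)) acyclic
  weight-y : ∀ φ → ∑ (weigh G φ y) vs ≡ φ y p
  weight-y φ with rest , vs↭ ← ∈⇒↭ p∈ with p≢ ∷ _ ← Unique-resp-↭ vs↭ unique = begin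
    ∑ (weigh G φ y) vs                      ≡⟨ ∑-↭ _ vs↭ ⟩
    weigh G φ y p + ∑ (weigh G φ y) rest    ≡⟨ cong₂ (λ i j → i * φ y p + j) (ind-yes yp)
                                                 (∑-cong rest λ {v} v∈ → cong (_* φ y v) (ind-no λ yv →
                                                   All.lookup p≢ v∈ (sym (sole-neighbour (Permₚ.∈-resp-↭ (↭-sym vs↭) (there v∈)) yv)))) ⟩
    φ y p + 0 + ∑ (λ _ → 0) rest            ≡⟨ cong₂ _+_ (+-identityʳ (φ y p)) (trans (∑-const 0 rest) (*-zeroʳ (length rest))) ⟩
    φ y p + 0                               ≡⟨ +-identityʳ (φ y p) ⟩
    φ y p                                   ∎
    where open ≡-Reasoning
  paths′ : ∀ {a b} → a ∈ y ∷ vs → b ∈ y ∷ vs →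
           ∃ λ l → Walk G a l b × Unique (a ∷ l) × (∀ {v} → v ∈ a ∷ l → v ∈ y ∷ vs)
  paths′ (here refl) (here refl) = [] , stop , [] ∷ [] , λ { (here refl) → here refl }
  paths′ (here refl) (there b∈) with l , w , l! , l⊆ ← paths p∈ b∈ =
    p ∷ l , step yp w , ∉⇒All≢ (y∉ ∘ l⊆) ∷ l! , λ { (here refl) → here refl ; (there v∈) → there (l⊆ v∈) }
  paths′ {a} (there a∈) (here refl) with l , w , l! , l⊆ ← paths a∈ p∈ =
    l ++ [ y ] , snoc w py ,
    Uniqueₚ.++⁺ l! ([] ∷ []) (λ { (v∈ , here refl) → y∉ (l⊆ v∈) }) ,
    λ v∈ → case-++ (∈-++⁻ (a ∷ l) v∈) l⊆
    where
    case-++ : ∀ {v xs} → v ∈ xs ⊎ v ∈ [ y ] → (∀ {v} → v ∈ xs → v ∈ vs) → v ∈ y ∷ vs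
    case-++ (inj₁ v∈)          ⊆vs = there (⊆vs v∈)
    case-++ (inj₂ (here refl)) ⊆vs = here refl
  paths′ (there a∈) (there b∈) with l , w , l! , l⊆ ← paths a∈ b∈ = l , w , l! , there ∘ l⊆
  grown : Grown G vs′
  grown = record
    { es      = es′
    ; brush   = brush′
    ; unique  = Unique-resp-↭ (↭-sym vs′↭) (∉⇒All≢ y∉ ∷ unique)
    ; weights = λ {φ} s → begin
        ∑₂ (weigh G φ) vs′                          ≡⟨ ∑₂-↭ (weigh-sym G s) vs′↭ ⟩
        ∑ (weigh G φ y) vs + ∑₂ (weigh G φ) vs      ≡⟨ cong₂ _+_ (trans (weight-y φ) (s y p)) (weights s) ⟩
        φ p y + ∑ (uncurry φ) es                    ≡⟨ ∑′ s ⟨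
        ∑ (uncurry φ) es′                           ∎
    ; paths   = λ a∈ b∈ → let l , w , l! , l⊆ = paths′ (Permₚ.∈-resp-↭ vs′↭ a∈) (Permₚ.∈-resp-↭ vs′↭ b∈)
                          in l , w , l! , Permₚ.∈-resp-↭ (↭-sym vs′↭) ∘ l⊆
    }
    where open ≡-Reasoning

-- Vertices of the walk already in the list are passed over, so the walk may repeat vertices.
reach : ∀ {m} {G : Graph m} → ¬ Cycle G → ∀ {vs} → Grown G vs → ∀ {a x} → a ∈ vs → Star (Adj G) a x →
        ∃ λ vs′ → Grown G vs′ × (∀ {v} → v ∈ vs → v ∈ vs′) × x ∈ vs′
reach acyclic {vs} gr a∈ ε = vs , gr , (λ v∈ → v∈) , a∈
reach acyclic {vs} gr a∈ (_◅_ {j = y} e walk) with y ∈? vs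
... | yes y∈ = reach acyclic gr y∈ walk
... | no  y∉
  with vs₁ , gr₁ , vs₁↭ ← grow acyclic gr a∈ e y∉
  with vs₂ , gr₂ , vs₁⊆ , x∈ ← reach acyclic gr₁ (Permₚ.∈-resp-↭ (↭-sym vs₁↭) (here refl)) walk =
  vs₂ , gr₂ , vs₁⊆ ∘ Permₚ.∈-resp-↭ (↭-sym vs₁↭) ∘ there , x∈

-- Connectivity gives a walk from `zero` to each vertex in turn. Growing never loses a vertex, so
-- the list ends up complete.
spanning : ∀ {m} {G : Graph m} → IsTree G → ∃ λ vs → Grown G vs × vs ↭ allFin m
spanning {suc m} {G} tree = finish (reach-all (allFin (suc m)))
  where
  open IsTree tree
  root : Grown G [ zero ]
  root = record
    { es = [] ; brush = single zero ; unique = [] ∷ [] ; weights = λ _ → refl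
    ; paths = λ { (here refl) (here refl) → [] , stop , [] ∷ [] , λ v∈ → v∈ } }
  reach-all : ∀ xs → ∃ λ vs → Grown G vs × zero ∈ vs × (∀ {x} → x ∈ xs → x ∈ vs)
  reach-all [] = [ zero ] , root , here refl , λ ()
  reach-all (x ∷ xs)
    with vs , gr , zero∈ , xs⊆ ← reach-all xs
    with vs′ , gr′ , vs⊆ , x∈ ← reach acyclic gr zero∈ (connected zero x) =
    vs′ , gr′ , vs⊆ zero∈ , λ { (here refl) → x∈ ; (there v∈) → vs⊆ (xs⊆ v∈) }
  finish : (∃ λ vs → Grown G vs × zero ∈ vs × (∀ {x} → x ∈ allFin (suc m) → x ∈ vs)) →
           ∃ λ vs → Grown G vs × vs ↭ allFin (suc m)
  finish (vs , gr , _ , all∈) =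
    vs , gr , same-elements (Grown.unique gr) (Uniqueₚ.allFin⁺ _) (λ _ → ∈-allFin _) all∈
spanning {zero} tree = contradiction (IsTree.nonempty tree) λ ()

-- Counting the edges of a graph

length-filter-∑ : ∀ {P : A → Set} (P? : Decidable P) xs → length (filter P? xs) ≡ ∑ (λ x → ind (does (P? x))) xs
length-filter-∑ P? [] = refl
length-filter-∑ P? (x ∷ xs) with does (P? x)
... | true  = cong suc (length-filter-∑ P? xs)
... | false = length-filter-∑ P? xs

∑-filter : ∀ {P : A → Set} (P? : Decidable P) f xs → ∑ f (filter P? xs) ≡ ∑ (λ x → ind (does (P? x)) * f x) xs
∑-filter P? f [] = refl
∑-filter P? f (x ∷ xs) with does (P? x)
... | true  = cong₂ _+_ (sym (+-identityʳ (f x))) (∑-filter P? f xs)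
... | false = ∑-filter P? f xs

∑-cartesianProduct : ∀ (f : A × C → ℕ) xs ys →
                     ∑ f (cartesianProduct xs ys) ≡ ∑ (λ x → ∑ (λ y → f (x , y)) ys) xs
∑-cartesianProduct f []       ys = refl
∑-cartesianProduct f (x ∷ xs) ys = trans (∑-++ f (map (x ,_) ys))
  (cong₂ _+_ (∑-map f (x ,_) ys) (∑-cartesianProduct f xs ys))

-- Diagonal and descending terms vanish, and in a sorted list the ascending pairs are those that
-- `∑₂` visits. This matches the condition u < v in `edges`.
∑∑-sorted : ∀ {_⊏_ : A → A → Set} {h k : A → A → ℕ} →
            (∀ {x y} → x ⊏ y → h x y ≡ k x y) → (∀ {x y} → x ⊏ y → h y x ≡ 0) → (∀ x → h x x ≡ 0) →
            ∀ {xs} → AllPairs _⊏_ xs → ∑ (λ x → ∑ (h x) xs) xs ≡ ∑₂ k xs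
∑∑-sorted up down diag [] = refl
∑∑-sorted {h = h} {k} up down diag {x ∷ xs} (x⊏ ∷ sorted) = cong₂ _+_
  (cong₂ _+_ (diag x) (∑-cong xs λ y∈ → up (All.lookup x⊏ y∈)))
  (trans (∑-cong xs λ {y} y∈ → cong (_+ ∑ (h y) xs) (down (All.lookup x⊏ y∈))) (∑∑-sorted up down diag sorted))

∑-edges : ∀ {n} (G : Graph n) φ → ∑ (uncurry φ) (edges G) ≡ ∑₂ (weigh G φ) (allFin n)
∑-edges {n} G φ = begin
  ∑ (uncurry φ) (edges G)                                   ≡⟨ ∑-filter edge? (uncurry φ) (pairs n) ⟩
  ∑ (λ p → ind (does (edge? p)) * uncurry φ p) (pairs n)    ≡⟨ ∑-cartesianProduct (λ p → ind (does (edge? p)) * uncurry φ p) (allFin n) (allFin n) ⟩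
  ∑ (λ u → ∑ (h u) (allFin n)) (allFin n)                   ≡⟨ ∑∑-sorted up down diag (AllPairsₚ.tabulate⁺-< λ i<j → i<j) ⟩
  ∑₂ (weigh G φ) (allFin n)                                 ∎
  where
  open ≡-Reasoning
  edge? : Decidable (uncurry λ u v → (u Fin.< v) × Adj G u v)
  edge? (u , v) = (u <? v) ×-dec adj? G u v
  h : Fin n → Fin n → ℕ
  h u v = ind (does (edge? (u , v))) * φ u v
  up : ∀ {u v} → u Fin.< v → h u v ≡ weigh G φ u v
  up {u} {v} u<v = cong (λ d → ind (d ∧ Graph.adj G u v) * φ u v) (dec-true (u <? v) u<v)
  down : ∀ {u v} → u Fin.< v → h v u ≡ 0
  down {u} {v} u<v = cong (λ d → ind (d ∧ Graph.adj G v u) * φ v u) (dec-false (v <? u) (<ᶠ-asym u<v))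
  diag : ∀ u → h u u ≡ 0
  diag u = cong (λ d → ind (d ∧ Graph.adj G u u) * φ u u) (dec-false (u <? u) (<ᶠ-irrefl refl))

edge-count : ∀ {n} (G : Graph n) → e G ≡ ∑₂ (weigh G λ _ _ → 1) (allFin n)
edge-count G = trans (sym (trans (∑-const 1 (edges G)) (*-identityʳ _))) (∑-edges G (λ _ _ → 1))

edgesInto-count : ∀ {m n} (G : Graph m) (H : Graph n) f →
                  edgesInto G H f ≡ ∑₂ (weigh G λ u v → ind (Graph.adj H (f u) (f v))) (allFin m)
edgesInto-count G H f = trans (length-filter-∑ _ (edges G)) (∑-edges G _)

-- Application to colourings of the complete graph.

twoColouring : ∀ {n} → Coloring n → TwoColouring (Fin n)
twoColouring c = record
  { red      = λ u v → ind (Graph.adj (R c) u v)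
  ; blue     = λ u v → ind (Graph.adj (B c) u v)
  ; red-sym  = adj-sym (R c)
  ; blue-sym = adj-sym (B c)
  ; loopless = λ v → cong₂ _+_ (ind-no (Graph.irreflexive (R c) v)) (ind-no (Graph.irreflexive (B c) v))
  ; bounded  = λ u v → not-both (Coloring.disjoint c u v)
  ; total    = λ {u} {v} u≢v → exactly-one (Coloring.cover c u v u≢v) (Coloring.disjoint c u v)
  }
  where
  not-both : ∀ {a b} → ¬ (T a × T b) → ind a + ind b ≤ 1
  not-both {true}  {true}  ¬ab = contradiction _ ¬ab
  not-both {true}  {false} _   = ≤-refl
  not-both {false} {true}  _   = ≤-refl
  not-both {false} {false} _   = z≤n
  exactly-one : ∀ {a b} → T a ⊎ T b → ¬ (T a × T b) → ind a + ind b ≡ 1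
  exactly-one {true}  {true}  _ ¬ab = contradiction _ ¬ab
  exactly-one {true}  {false} _ _   = refl
  exactly-one {false} {true}  _ _   = refl
  exactly-one {false} {false} (inj₁ ()) _
  exactly-one {false} {false} (inj₂ ()) _

map-injective : ∀ {f : A → C} {xs} → Unique (map f xs) →
                ∀ {x y} → x ∈ xs → y ∈ xs → f x ≡ f y → x ≡ y
map-injective (_   ∷ _)  (here refl) (here refl) _  = refl
map-injective {f = f} (fx≢ ∷ _) (here refl) (there y∈)  eq = contradiction eq (All.lookup fx≢ (∈-map⁺ f y∈))
map-injective {f = f} (fx≢ ∷ _) (there x∈)  (here refl) eq = contradiction (sym eq) (All.lookup fx≢ (∈-map⁺ f x∈))
map-injective (_   ∷ !)  (there x∈)  (there y∈)  eq = map-injective ! x∈ y∈ eq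

tree-forces : ∀ {m} n (T : Graph m) → IsTree T → Forces n T ((e T ∸ 1) * n)
tree-forces {m} n T tree c dense r b r+b≡ with vs , gr , vs↭ ← spanning tree = record
  { f         = embed
  ; injective = injective-on-all
  ; red       = trans (count (R c)) red-count
  ; blue      = trans (count (B c)) blue-count
  }
  where
  open Grown gr
  open TwoColouring (twoColouring c) using (red; blue)
  -- The grown list is a permutation of all vertices, so sums over the graph `T` become sums over
  -- the edges of its brush.
  count-all : ∀ {φ} → Symmetric φ → ∑₂ (weigh T φ) (allFin m) ≡ ∑ (uncurry φ) es
  count-all s = trans (∑₂-↭ (weigh-sym T s) (↭-sym vs↭)) (weights s)
  size : length es ≡ e T
  size = sym (trans (edge-count T) (trans (count-all λ _ _ → refl) (trans (∑-const 1 es) (*-identityʳ _))))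
  dense-in : ∀ (G : Graph n) → (e T ∸ 1) * n < e G →
             (length es ∸ 1) * length (allFin n) < ∑₂ (λ u v → ind (Graph.adj G u v)) (allFin n)
  dense-in G = subst₂ _<_ (cong₂ (λ i j → (i ∸ 1) * j) (sym size) (sym (length-tabulate {n = n} λ i → i)))
    (trans (edge-count G) (∑₂-cong (λ u v → *-identityʳ _) (allFin n)))
  E : Embedding (twoColouring c) (allFin n) vs es r b
  E = coloured-copy (Uniqueₚ.allFin⁺ n) brush unique
        (dense-in (R c) (≤-trans dense (m⊓n≤m (e (R c)) (e (B c)))))
        (dense-in (B c) (≤-trans dense (m⊓n≤n (e (R c)) (e (B c)))))
        r b (trans r+b≡ (sym size))
  open Embedding E
  count : ∀ (H : Graph n) → edgesInto T H embed ≡ ∑ (uncurry λ u v → ind (Graph.adj H (embed u) (embed v))) es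
  count H = trans (edgesInto-count T H embed) (count-all λ u v → adj-sym H (embed u) (embed v))
  injective-on-all : Injective _≡_ _≡_ embed
  injective-on-all = map-injective (Unique-resp-↭ (Permₚ.map⁺ embed vs↭) distinct) (∈-allFin _) (∈-allFin _)

theorem4p3 : ∀ (n k : ℕ) → n ≥ 1 → k ≥ 1 → n ≥ 4 * k →
    ∀ {m : ℕ} (T : Graph m) → IsTree T → e T ≡ k →
    ot n T ≤ (k ∸ 1) * n
-- `ot` is the least forcing value, so any forcing value bounds it from above.
theorem4p3 n _ _ _ _ T tree refl = proj₂ (ot-isMinimum n T) ((e T ∸ 1) * n) (tree-forces n T tree)
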